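{- Let $a,b,a',b'\ge 1$ with $a+b=a'+b'$. Let $\rho$ and $\rho'$ be canonical sequential forms of non-crossing partitions of lengths $a$ and $a'$, respectively; if $b\ge 2$ assume that $\rho$ starts with a single $1$ (its initial run of $1$'s has length exactly one), and if $b'\ge 2$ assume that $\rho'$ starts with a single $1$. Let $\tau=(\rho+1)1^b$ and $\tau'=(\rho'+1)1^{b'}$. Then $\tau\equiv\tau'$ as subwords on $NC_n$; that is, for every $n\ge 0$ and every $k\ge 0$, the number of $\pi\in NC_n$ with $\mu_\tau(\pi)=k$ equals the number of $\pi\in NC_n$ with $\mu_{\tau'}(\pi)=k$.
   Context: A set partition of $[n]=\{1,\dots,n\}$ with blocks $B_1,\dots,B_k$ ordered so that $\min B_1<\cdots<\min B_k$ is represented by its canonical sequential form $\pi=\pi_1\cdots\pi_n$, where $i\in B_{\pi_i}$ for each $i$; $n$ is its length. It is non-crossing if $\pi$ contains no (not necessarily consecutive) subsequence of the form $a\,b\,a\,b$ with $a<b$. $NC_n$ denotes the set of non-crossing partitions of $[n]$, identified with their canonical sequential forms ($NC_0$ consists of the empty partition). A subword pattern is a finite sequence $\tau=\tau_1\cdots\tau_k$ of positive integers whose set of distinct letters is $[\ell]$ for some $\ell$. An occurrence of $\tau$ in a sequence $\sigma_1\cdots\sigma_n$ is an index $i\in[n-k+1]$ such that the string of consecutive letters $\sigma_i\cdots\sigma_{i+k-1}$ is order-isomorphic to $\tau$ (same relative order, including equalities). $\mu_\tau(\pi)$ denotes the number of occurrences of $\tau$ in $\pi$. $\rho+1$ is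 the sequence obtained by adding $1$ to each entry of $\rho$, $1^b$ is the word of $b$ ones, and juxtaposition is concatenation. -}

module Defs where

open import Data.Fin as Fin using (Fin; toℕ; cast)
open import Data.Fin.Properties using (all?)
open import Data.Fin.Subset using (Subset; Nonempty) renaming (_∈_ to _∈ˢ_)
open import Data.List using (List; []; _∷_; _++_; length; lookup; map; filter; take; drop; replicate; tabulate; takeWhile; upTo)
open import Data.List.Membership.Propositional using (_∈_)
open import Data.List.Relation.Binary.Sublist.Propositional using (_⊆_)
open import Data.List.Relation.Unary.Unique.Propositional using (Unique)
open import Data.Nat using (ℕ; suc; _∸_; _<_; _<?_; _≟_)
open import Data.Nat.Properties using (≡-irrelevant)
open import Data.Product using (Σ-syntax; ∃-syntax; _×_; _,_; proj₁; proj₂)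
open import Function using (_∘_; _⇔_; mk⇔; Equivalence)
open import Relation.Binary.PropositionalEquality using (_≡_; subst)
open import Relation.Nullary using (¬_; Dec; yes; no)
open import Relation.Nullary.Decidable using (map′; _×-dec_; _→-dec_)
open import Relation.Unary using (Pred)

Word : Set
Word = List ℕ

IsMin : ∀ {n} → Fin n → Subset n → Set
IsMin x S = x ∈ˢ S × (∀ y → y ∈ˢ S → x Fin.≤ y)

-- [n] is modelled by Fin n, so that x : Fin n stands for the element suc (toℕ x);
-- likewise the blocks B₁, …, B_k are indexed by Fin k.
record SetPartition (n : ℕ) : Set where
  field
    size     : ℕ
    block    : Fin size → Subset n
    nonempty : ∀ j → Nonempty (block j)
    disjoint : ∀ {i j x} → x ∈ˢ block i → x ∈ˢ block j → i ≡ j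
    cover    : ∀ x → ∃[ j ] x ∈ˢ block j
    ordered  : ∀ {i j x y} → i Fin.< j → IsMin x (block i) → IsMin y (block j) → x Fin.< y

  -- The suc turns the 0-based block index into a positive letter.
  canonicalForm : Word
  canonicalForm = tabulate (λ x → suc (toℕ (proj₁ (cover x))))

NonCrossing : Pred Word _
NonCrossing π = ∀ {a b} → a < b → ¬ (a ∷ b ∷ a ∷ b ∷ [] ⊆ π)

-- Non-crossing partitions of [n], identified with their canonical sequential forms.
NC : ℕ → Pred Word _
NC n π = (Σ[ P ∈ SetPartition n ] π ≡ SetPartition.canonicalForm P) × NonCrossing π

OrderIsomorphic : Word → Word → Set
OrderIsomorphic u v = Σ[ eq ∈ length u ≡ length v ] ∀ (i j : Fin (length u)) →
  (lookup u i < lookup u j ⇔ lookup v (cast eq i) < lookup v (cast eq j)) ×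
  (lookup u i ≡ lookup u j ⇔ lookup v (cast eq i) ≡ lookup v (cast eq j))

private
  _⇔?_ : {A B : Set} → Dec A → Dec B → Dec (A ⇔ B)
  a? ⇔? b? = map′ (λ (f , g) → mk⇔ f g) (λ e → Equivalence.to e , Equivalence.from e)
                  ((a? →-dec b?) ×-dec (b? →-dec a?))

orderIsomorphic? : ∀ u v → Dec (OrderIsomorphic u v)
orderIsomorphic? u v with length u ≟ length v
... | no  neq = no (neq ∘ proj₁)
... | yes eq  = map′ (eq ,_) fromIso (all? λ i → all? λ j →
    ((lookup u i <? lookup u j) ⇔? (lookup v (cast eq i) <? lookup v (cast eq j))) ×-dec
    ((lookup u i ≟ lookup u j) ⇔? (lookup v (cast eq i) ≟ lookup v (cast eq j))))
  where
  Preserves : length u ≡ length v → Set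
  Preserves e = ∀ (i j : Fin (length u)) →
    (lookup u i < lookup u j ⇔ lookup v (cast e i) < lookup v (cast e j)) ×
    (lookup u i ≡ lookup u j ⇔ lookup v (cast e i) ≡ lookup v (cast e j))
  fromIso : OrderIsomorphic u v → Preserves eq
  fromIso (e , p) = subst Preserves (≡-irrelevant e eq) p

-- Number of occurrences of τ in σ.  Starting positions are 0-based: i ranges over
-- 0, …, n ∸ k, and over nothing when k > n.
μ : Word → Word → ℕ
μ τ σ = length (filter (λ i → orderIsomorphic? (take k (drop i σ)) τ) (upTo (suc n ∸ k)))
  where
  k n : ℕ
  k = length τ
  n = length σ

initialOnes : Word → ℕ
initialOnes = length ∘ takeWhile (_≟ 1)

-- (ρ + 1) 1ᵇ
pattern[_,_] : Word → ℕ → Word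
pattern[ ρ , b ] = map suc ρ ++ replicate b 1

-- The words satisfying P are finite in number, and there are exactly m of them.
HasCardinality : Pred Word _ → ℕ → Set
HasCardinality P m = ∃[ xs ] Unique xs × (∀ w → w ∈ xs ⇔ P w) × length xs ≡ m

-- τ ≡ τ′ as subwords on NCₙ.
_≡ᴺᶜ_ : Word → Word → Set
τ ≡ᴺᶜ τ′ = ∀ n k → ∃[ m ]
  HasCardinality (λ π → NC n π × μ τ  π ≡ k) m ×
  HasCardinality (λ π → NC n π × μ τ′ π ≡ k) m

{-# OPTIONS --safe #-}
-- Between two consecutive letters of a block, a non-crossing partition is a non-crossing
-- partition on fresh letters; so non-crossing partitions correspond to binary trees
-- node L R = 1 L R, with L on fresh letters and R continuing the block of 1.  An occurrence
-- of (ρ + 1) 1ᵇ in 1 L R lies in L, or in R, or consists of a suffix of L isomorphic to ρ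
-- and an initial run of b ones in R.  The L with such a suffix arise from a nonempty L′ by
-- replacing the last letter of L′ with a copy of ρ, and the R with such a run are 1ᵇ⁻¹ R′
-- with R′ nonempty; neither operation changes the number of occurrences (the former because
-- ρ starts with a single 1 when b ≥ 2).  Hence A(n) = Σ q^μ(π), over π ∈ NCₙ, satisfies
--   A(n+1) = Σ_{i+j=n} A(i) A(j) + (q − 1) Σ_{i+j=n+2−a−b; i,j≥1} A(i) A(j),
-- which involves only a + b.  The distribution of μ is read off A(n) at one large q, as the
-- digits in base q.
module Submission where

open import Defs
open import Data.Bool using (true; false)
open import Data.Fin as Fin using (Fin; zero; suc; toℕ; fromℕ<; cast)
open import Data.Fin.Properties using (toℕ<n; toℕ-fromℕ<; toℕ-injective; cast-is-id)
open import Data.Fin.Subset using (Subset; Nonempty; inside; outside) renaming (_∈_ to _∈ˢ_)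
open import Data.List using (List; []; _∷_; _++_; length; map; lookup; tabulate; take; drop; replicate; filter; upTo; applyUpTo; cartesianProductWith)
open import Data.List.Membership.Propositional using (_∈_; _∉_)
open import Data.List.Membership.Propositional.Properties
open import Data.List.Membership.Propositional.Properties.WithK using (unique∧set⇒bag)
open import Data.List.Properties using (map-++; map-∘; map-id; map-replicate; map-tabulate; map-upTo; length-++; length-map; length-replicate; length-tabulate; length-take; tabulate-lookup; tabulate-cong; take-map; take++drop≡id; ++-assoc; ++-identityʳ; ∷-injective; ∷-injectiveˡ; ∷-injectiveʳ)
open import Data.List.Relation.Binary.BagAndSetEquality using (∼bag⇒↭)
open import Data.List.Relation.Binary.Permutation.Propositional.Properties as ↭ using ()
open import Data.List.Relation.Binary.Sublist.Propositional as Sublist using (_⊆_; []; _∷_; _∷ʳ_; ⊆-refl; ⊆-trans; from∈)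
open import Data.List.Relation.Binary.Sublist.Propositional.Properties as Sublistₚ using ()
open import Data.List.Relation.Unary.All as All using (All; []; _∷_)
open import Data.List.Relation.Unary.All.Properties as Allₚ using ()
open import Data.List.Relation.Unary.AllPairs using ([]; _∷_)
open import Data.List.Relation.Unary.Any using (here; there; index)
open import Data.List.Relation.Unary.Any.Properties using (lookup-index)
open import Data.List.Relation.Unary.Unique.Propositional using (Unique)
open import Data.List.Relation.Unary.Unique.Propositional.Properties as Uniqueₚ using ()
open import Data.Nat
open import Data.Nat.DivMod using (_%_; [m+kn]%n≡m%n; m<n⇒m%n≡m)
open import Data.Nat.ListAction using (sum)
open import Data.Nat.ListAction.Properties using (sum-++; sum-↭)
open import Data.Nat.Properties
open import Data.Nat.Solver using (module +-*-Solver)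
open import Data.Product using (∃-syntax; _×_; _,_; proj₁; proj₂; map₁; map₂; swap)
open import Data.Sum as Sum using (_⊎_; inj₁; inj₂)
open import Data.Vec as Vec using (_∷_; here; there)
open import Data.Vec.Properties using (lookup∘tabulate; lookup⇒[]=; []=⇒lookup)
open import Data.Empty using (⊥)
open import Function using (_∘_; id; _⇔_; mk⇔; Equivalence)
open import Function.Construct.Composition using (_⇔-∘_)
open import Function.Construct.Symmetry using (⇔-sym)
open import Relation.Binary.Definitions using (tri<; tri≈; tri>)
open import Relation.Binary.PropositionalEquality
open import Relation.Nullary using (¬_; Dec; yes; no; contradiction; does; _because_)
open import Relation.Nullary.Decidable as Dec using (dec-true; map′)

open Equivalence using (to; from)

-- Trees and non-crossing partitions

-- The factor q - 1 comes from linearising an exponent. The copy of `ρ` at the end of `L` and the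
-- run at the start of `R` are independent conditions, and each contributes 0 or 1, since a word has
-- only one suffix of a given length. So the node adds a product e of two indicators to the
-- exponent, and q^e = 1 + (q - 1) e separates the sum into one over `L` and one over `R`. The
-- obstacle is that these two operations must preserve the statistic. If `ρ` began with 11, grafting
-- it onto the last letter of an initial run of ones would lengthen that run and could create the b
-- ones of a new occurrence. For b = 1 only the presence of a one matters, and grafting cannot
-- change that. With q a natural number written t + 1, the whole argument stays in ℕ: there are no
-- polynomials and no subtraction. Uniqueness of base-q digits then takes the place of comparing
-- coefficients.

data Tree : Set where
  nil  : Tree
  node : Tree → Tree → Tree

node-injective : ∀ {L R L′ R′} → node L R ≡ node L′ R′ → L ≡ L′ × R ≡ R′
node-injective refl = refl , refl

size : Tree → ℕ
size nil        = 0
size (node L R) = suc (size L + size R)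

-- innerBlocks omits the block that the tree continues.
mutual
  blocks : Tree → ℕ
  blocks nil          = 0
  blocks T@(node _ _) = suc (innerBlocks T)

  innerBlocks : Tree → ℕ
  innerBlocks nil        = 0
  innerBlocks (node L R) = innerBlocks R + blocks L

-- node L R stands for an element of the current block c, followed by a partition L
-- on fresh letters f, f + 1, … and by the rest R of the block c.
word : Tree → ℕ → ℕ → Word
word nil        c f = []
word (node L R) c f = c ∷ word L f (suc f) ++ word R c (blocks L + f)

length-word : ∀ T c f → length (word T c f) ≡ size T
length-word nil        c f = refl
length-word (node L R) c f = cong suc (trans (length-++ (word L f (suc f)))
  (cong₂ _+_ (length-word L f (suc f)) (length-word R c (blocks L + f))))

-- All letters other than `c` are offsets from `f`, so a map that acts from `f` upwards as a
-- translation commutes with the construction, wherever it sends `c`.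
map-word : ∀ (φ : ℕ → ℕ) T c f → (∀ k → φ (k + f) ≡ k + φ f) →
           map φ (word T c f) ≡ word T (φ c) (φ f)
map-word φ nil        c f shift = refl
map-word φ (node L R) c f shift = cong (φ c ∷_) (begin
  map φ (word L f (suc f) ++ word R c (blocks L + f))
    ≡⟨ map-++ φ (word L f (suc f)) _ ⟩
  map φ (word L f (suc f)) ++ map φ (word R c (blocks L + f))
    ≡⟨ cong₂ _++_ (map-word φ L f (suc f) shiftL) (map-word φ R c (blocks L + f) shiftR) ⟩
  word L (φ f) (φ (suc f)) ++ word R (φ c) (φ (blocks L + f))
    ≡⟨ cong₂ (λ x y → word L (φ f) x ++ word R (φ c) y) (shift 1) (shift (blocks L)) ⟩
  word L (φ f) (suc (φ f)) ++ word R (φ c) (blocks L + φ f) ∎)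
  where
  open ≡-Reasoning
  shiftL : ∀ k → φ (k + suc f) ≡ k + φ (suc f)
  shiftL k = trans (cong φ (+-suc k f)) (trans (shift (suc k))
    (trans (sym (+-suc k (φ f))) (cong (k +_) (sym (shift 1)))))
  shiftR : ∀ k → φ (k + (blocks L + f)) ≡ k + φ (blocks L + f)
  shiftR k = trans (cong φ (sym (+-assoc k (blocks L) f))) (trans (shift (k + blocks L))
    (trans (+-assoc k (blocks L) (φ f)) (cong (k +_) (sym (shift (blocks L))))))

-- Restricted growth: the letters below m have been used before the word π starts,
-- and those below m′ have been used when it ends.
data RestrictedGrowth : ℕ → Word → ℕ → Set where
  []  : ∀ {m} → RestrictedGrowth m [] m
  old : ∀ {m m′ x π} → x < m → RestrictedGrowth m π m′ → RestrictedGrowth m (x ∷ π) m′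
  new : ∀ {m m′ π} → RestrictedGrowth (suc m) π m′ → RestrictedGrowth m (m ∷ π) m′

rg-++⁺ : ∀ {u v m₁ m₂ m₃} → RestrictedGrowth m₁ u m₂ → RestrictedGrowth m₂ v m₃ →
         RestrictedGrowth m₁ (u ++ v) m₃
rg-++⁺ []        s = s
rg-++⁺ (old p r) s = old p (rg-++⁺ r s)
rg-++⁺ (new r)   s = new (rg-++⁺ r s)

rg-++⁻ : ∀ u {v m₁ m₃} → RestrictedGrowth m₁ (u ++ v) m₃ →
         ∃[ m₂ ] RestrictedGrowth m₁ u m₂ × RestrictedGrowth m₂ v m₃
rg-++⁻ []      r         = _ , [] , r
rg-++⁻ (x ∷ u) (old p r) with _ , s , t ← rg-++⁻ u r = _ , old p s , t
rg-++⁻ (x ∷ u) (new r)   with _ , s , t ← rg-++⁻ u r = _ , new s , t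

rg-functional : ∀ {u m m₁ m₂} → RestrictedGrowth m u m₁ → RestrictedGrowth m u m₂ → m₁ ≡ m₂
rg-functional []        []        = refl
rg-functional (old p r) (old q s) = rg-functional r s
rg-functional (old p r) (new s)   = contradiction p (n≮n _)
rg-functional (new r)   (old q s) = contradiction q (n≮n _)
rg-functional (new r)   (new s)   = rg-functional r s

rg-used : ∀ {u m m′ y} → RestrictedGrowth m u m′ → m ≤ y → y < m′ → y ∈ u
rg-used []        m≤y y<m′ = contradiction y<m′ (≤⇒≯ m≤y)
rg-used (old p r) m≤y y<m′ = there (rg-used r m≤y y<m′)
rg-used {m = m} {y = y} (new r) m≤y y<m′ with m ≟ y
... | yes refl = here refl
... | no  m≢y  = there (rg-used r (≤∧≢⇒< m≤y m≢y) y<m′)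

mutual
  rg-inner : ∀ T {c f} → c < f → RestrictedGrowth f (word T c f) (innerBlocks T + f)
  rg-inner nil        c<f = []
  rg-inner (node L R) {c} {f} c<f = old c<f (rg-++⁺ (rg-word L)
    (subst (RestrictedGrowth _ _) (sym (+-assoc (innerBlocks R) (blocks L) f))
      (rg-inner R (<-≤-trans c<f (m≤n+m f (blocks L))))))

  rg-word : ∀ T {f} → RestrictedGrowth f (word T f (suc f)) (blocks T + f)
  rg-word nil = []
  rg-word T@(node _ _) {f} with rg-inner T (n<1+n f)
  ... | old _ r = new (subst (RestrictedGrowth _ _) (+-suc (innerBlocks T) f) r)

rg-bound : ∀ {u m m′} → RestrictedGrowth m u m′ → m ≤ m′ × All (_< m′) u
rg-bound []        = ≤-refl , []
rg-bound (old p r) with q , s ← rg-bound r = q , <-≤-trans p q ∷ s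
rg-bound (new r)   with q , s ← rg-bound r = <⇒≤ q , q ∷ s

word-≥ : ∀ T {c f} → All (λ x → x ≡ c ⊎ f ≤ x) (word T c f)
word-≥ nil = []
word-≥ (node L R) {c} {f} = inj₁ refl ∷ Allₚ.++⁺
  (All.map (λ { (inj₁ refl) → inj₂ ≤-refl ; (inj₂ p) → inj₂ (<⇒≤ p) }) (word-≥ L))
  (All.map (λ { (inj₁ x≡c) → inj₁ x≡c
              ; (inj₂ p) → inj₂ (≤-trans (m≤n+m f (blocks L)) p) }) (word-≥ R))

word-fresh-≥ : ∀ T {f} → All (f ≤_) (word T f (suc f))
word-fresh-≥ T = All.map (λ { (inj₁ refl) → ≤-refl ; (inj₂ p) → <⇒≤ p }) (word-≥ T)

-- `L` stays in the interval from `f` up to, but excluding, `blocks L + f`; `R` uses only `c` and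
-- letters beyond that interval.
word-disjoint : ∀ L R {c f x} → c < f →
                x ∈ word L f (suc f) → x ∈ word R c (blocks L + f) → ⊥
word-disjoint L R c<f x∈L x∈R with All.lookup (word-≥ R) x∈R
... | inj₁ refl = <⇒≱ c<f (All.lookup (word-fresh-≥ L) x∈L)
... | inj₂ p    = <⇒≱ (All.lookup (proj₂ (rg-bound (rg-word L))) x∈L) p

-- Words of trees avoid crossings

⊆-++⁻ : ∀ {s : Word} u {v} → s ⊆ u ++ v → ∃[ s₁ ] ∃[ s₂ ] s ≡ s₁ ++ s₂ × s₁ ⊆ u × s₂ ⊆ v
⊆-++⁻ []      p          = [] , _ , refl , [] , p
⊆-++⁻ (x ∷ u) (.x ∷ʳ p)  with s₁ , s₂ , eq , q , r ← ⊆-++⁻ u p = s₁ , s₂ , eq , x ∷ʳ q , r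
⊆-++⁻ (x ∷ u) (refl ∷ p) with s₁ , s₂ , refl , q , r ← ⊆-++⁻ u p = x ∷ s₁ , s₂ , refl , refl ∷ q , r

⊆-∷⁻ : ∀ {x y : ℕ} {s v} → x ∷ s ⊆ y ∷ v → (x ≡ y × s ⊆ v) ⊎ (x ∷ s ⊆ v)
⊆-∷⁻ (refl ∷ p) = inj₁ (refl , p)
⊆-∷⁻ (_ ∷ʳ p)   = inj₂ p

∈-⊆ : ∀ {x : ℕ} {s u} → x ∈ s → s ⊆ u → x ∈ u
∈-⊆ x∈s s⊆u = Sublist.lookup s⊆u x∈s

NonCrossing-⊆ : ∀ {u v} → u ⊆ v → NonCrossing v → NonCrossing u
NonCrossing-⊆ u⊆v nc a<b p = nc a<b (⊆-trans p u⊆v)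

-- Neighbours in `a b a b` differ, so a crossing uses at most one of the two adjacent copies of `c`.
NonCrossing-dup : ∀ {c v} → NonCrossing (c ∷ v) → NonCrossing (c ∷ c ∷ v)
NonCrossing-dup nc a<b (_ ∷ʳ p)            = nc a<b p
NonCrossing-dup nc a<b (refl ∷ (_ ∷ʳ p))   = nc a<b (refl ∷ p)
NonCrossing-dup nc a<b (refl ∷ (refl ∷ p)) = n≮n _ a<b

-- Cases by how many letters of a crossing fall into `u`. A crossing that meets both `u` and its
-- complement would need a letter common to `u` and `v`, or a `c` inside `u`.
NonCrossing-insert : ∀ {c} u v → (∀ {x} → x ∈ u → x ∈ v → ⊥) → c ∉ u →
                     NonCrossing u → NonCrossing (c ∷ v) → NonCrossing (c ∷ u ++ v)
NonCrossing-insert {c} u v disj c∉u ncu ncv {a} {b} a<b p with ⊆-∷⁻ p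
... | inj₁ (refl , q) with ⊆-++⁻ u q
...   | []            , _           , refl , _ , s = ncv a<b (refl ∷ s)
...   | _ ∷ []        , _           , refl , r , s = disj (∈-⊆ (here refl) r) (∈-⊆ (there (here refl)) s)
...   | _ ∷ _ ∷ []     , _          , refl , r , s = c∉u (∈-⊆ (there (here refl)) r)
...   | _ ∷ _ ∷ _ ∷ [] , _          , refl , r , s = c∉u (∈-⊆ (there (here refl)) r)
NonCrossing-insert {c} u v disj c∉u ncu ncv {a} {b} a<b p | inj₂ q with ⊆-++⁻ u q
...   | []                    , _ , refl , _ , s = ncv a<b (c ∷ʳ s)
...   | _ ∷ []                , _ , refl , r , s = disj (∈-⊆ (here refl) r) (∈-⊆ (there (here refl)) s)
...   | _ ∷ _ ∷ []            , _ , refl , r , s = disj (∈-⊆ (here refl) r) (∈-⊆ (here refl) s)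
...   | _ ∷ _ ∷ _ ∷ []        , _ , refl , r , s = disj (∈-⊆ (there (here refl)) r) (∈-⊆ (here refl) s)
...   | _ ∷ _ ∷ _ ∷ _ ∷ []    , _ , refl , r , s = ncu a<b r

-- The `c` in front stands for an earlier element of the block that `T` continues. It has to be in
-- the induction hypothesis for `R`, because a crossing may begin at the letter of the node and end
-- in `R`.
word-nonCrossing : ∀ T {c f} → c < f → NonCrossing (c ∷ word T c f)
word-nonCrossing nil        c<f a<b (refl ∷ ())
word-nonCrossing (node L R) {c} {f} c<f = NonCrossing-dup
  (NonCrossing-insert (word L f (suc f)) (word R c (blocks L + f))
    (word-disjoint L R c<f) (λ c∈ → <⇒≱ c<f (All.lookup (word-fresh-≥ L) c∈))
    (NonCrossing-⊆ (f ∷ʳ ⊆-refl) (word-nonCrossing L (n<1+n f)))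
    (word-nonCrossing R (<-≤-trans c<f (m≤n+m f (blocks L)))))

-- Decoding a word into a tree

data HeadedBy (c : ℕ) : Word → Set where
  []   : HeadedBy c []
  head : ∀ {v} → HeadedBy c (c ∷ v)

word-headed : ∀ T {c f} → HeadedBy c (word T c f)
word-headed nil        = []
word-headed (node L R) = head

break : ∀ c π → ∃[ u ] ∃[ v ] π ≡ u ++ v × c ∉ u × HeadedBy c v
break c [] = [] , [] , refl , (λ ()) , []
break c (x ∷ π) with x ≟ c
... | yes refl = [] , x ∷ π , refl , (λ ()) , head
... | no  x≢c with u , v , refl , c∉u , h ← break c π =
  x ∷ u , v , refl , (λ { (here refl) → x≢c refl ; (there p) → c∉u p }) , h

-- Both cuts lie just before the first `c`, or at the end if there is none. Hence a word determines
-- where `L` ends and `R` begins.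
break-unique : ∀ {c} u u′ {v v′} → c ∉ u → c ∉ u′ → HeadedBy c v → HeadedBy c v′ →
               u ++ v ≡ u′ ++ v′ → u ≡ u′ × v ≡ v′
break-unique []      []       _   _    _    _    eq   = refl , eq
break-unique []      (x ∷ u′) _   c∉u′ head _    refl = contradiction (here refl) c∉u′
break-unique (x ∷ u) []       c∉u _    _    head refl = contradiction (here refl) c∉u
break-unique (x ∷ u) (x′ ∷ u′) c∉u c∉u′ h h′ eq
  with refl , eq′ ← ∷-injective eq
  with refl , refl ← break-unique u u′ (c∉u ∘ there) (c∉u′ ∘ there) h h′ eq′ = refl , refl

word-injective : ∀ T T′ {c f} → c < f → word T c f ≡ word T′ c f → T ≡ T′
word-injective nil        nil          _ _ = refl
word-injective (node L R) (node L′ R′) {c} {f} c<f eq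
  with eqL , eqR ← break-unique (word L f (suc f)) (word L′ f (suc f))
         (λ c∈ → <⇒≱ c<f (All.lookup (word-fresh-≥ L) c∈))
         (λ c∈ → <⇒≱ c<f (All.lookup (word-fresh-≥ L′) c∈))
         (word-headed R) (word-headed R′) (proj₂ (∷-injective eq))
  with refl ← word-injective L L′ (n<1+n f) eqL
  = cong (node L) (word-injective R R′ (<-≤-trans c<f (m≤n+m f (blocks L))) eqR)

-- This is where non-crossing enters the decoding: a letter `x` introduced in `u` and met again
-- after the `c` that heads `v` would give `c x c x`.
used-later : ∀ {c m m₁ u v x} → c < m → NonCrossing (c ∷ u ++ v) → RestrictedGrowth m u m₁ →
             HeadedBy c v → x ≡ c ⊎ m ≤ x → x ∈ v → x ≡ c ⊎ m₁ ≤ x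
used-later _ _ _ _    (inj₁ x≡c) _           = inj₁ x≡c
used-later _ _ _ head (inj₂ p)   (here refl) = inj₁ refl
used-later {m₁ = m₁} {x = x} c<m nc r head (inj₂ p) (there x∈v) with m₁ ≤? x
... | yes q = inj₂ q
... | no ¬q = contradiction
  (refl ∷ Sublistₚ.++⁺ (from∈ (rg-used r p (≰⇒> ¬q))) (refl ∷ from∈ x∈v)) (nc (<-≤-trans c<m p))

mutual
  -- After the leading `c`, the part before the next `c` is `L` and the remainder is `R`. These
  -- parts come out of `break` and are not structural subterms, so `k`, a bound on the length,
  -- drives the recursion.
  parse : ∀ k {π c m m′} → length π ≤ k → RestrictedGrowth m π m′ → c < m → HeadedBy c π →
          All (λ x → x ≡ c ⊎ m ≤ x) π → NonCrossing π → ∃[ T ] π ≡ word T c m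
  parse k _ _ _ [] _ _ = nil , refl
  parse (suc k) _ (new r) c<m head _ _ = contradiction c<m (n≮n _)
  parse (suc k) {c ∷ π} {m = m} (s≤s len) (old _ r) c<m head (_ ∷ letters) nc
    with u , v , refl , c∉u , h ← break c π
    with m₁ , ru , rv ← rg-++⁻ u r
    with L , refl ← parseFresh k u
           (≤-trans (subst (length u ≤_) (sym (length-++ u)) (m≤m+n _ _)) len) ru
           (All.tabulate λ x∈u → Sum.fromInj₂
             (λ { refl → contradiction x∈u c∉u }) (All.lookup (Allₚ.++⁻ˡ u letters) x∈u))
           (NonCrossing-⊆ (c ∷ʳ Sublistₚ.++⁺ʳ v ⊆-refl) nc)
    -- This identifies the growth bound `m₁` after `u` with `blocks L + m`, the first fresh letter
    -- that `word` hands to `R`.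
    with refl ← rg-functional ru (rg-word L)
    with R , refl ← parse k
           (≤-trans (subst (length v ≤_) (sym (length-++ u)) (m≤n+m _ (length u))) len)
           rv (<-≤-trans c<m (m≤n+m m (blocks L))) h
           (All.tabulate λ x∈v →
             used-later c<m nc ru h (All.lookup (Allₚ.++⁻ʳ u letters) x∈v) x∈v)
           (NonCrossing-⊆ (c ∷ʳ Sublistₚ.++⁺ˡ u ⊆-refl) nc)
    = node L R , refl

  parseFresh : ∀ k u {m m′} → length u ≤ k → RestrictedGrowth m u m′ → All (m ≤_) u →
               NonCrossing u → ∃[ L ] u ≡ word L m (suc m)
  parseFresh k []      _   _         _         _  = nil , refl
  parseFresh k (x ∷ u) _   (old p r) (q ∷ _)   _  = contradiction p (≤⇒≯ q)
  parseFresh k (m ∷ u) len (new r)   (_ ∷ qs)  nc = parse k len (old (n<1+n m) r) (n<1+n m) head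
    (inj₁ refl ∷ All.map (λ p → Sum.swap (Sum.map₂ sym (m≤n⇒m<n∨m≡n p))) qs) nc

-- Set partitions and restricted growth words

minimum : ∀ {n} (S : Subset n) → Nonempty S → ∃[ x ] IsMin x S
minimum (inside  ∷ S) _                   = zero , here , (λ _ _ → z≤n)
minimum (outside ∷ S) (suc x , there x∈S) with y , y∈S , least ← minimum S (x , x∈S) =
  suc y , there y∈S , λ { (suc z) (there z∈S) → s≤s (least z z∈S) }

rg-tabulate : ∀ {n} (f : Fin n → ℕ) m →
              (∀ x {y} → m ≤ y → y < f x → ∃[ x′ ] x′ Fin.< x × f x′ ≡ y) →
              ∃[ m′ ] RestrictedGrowth m (tabulate f) m′
rg-tabulate {zero}  f m earlier = m , []
rg-tabulate {suc n} f m earlier with <-cmp (f zero) m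
... | tri< f0<m _ _ = let m′ , r = rg-tabulate (f ∘ suc) m tail-earlier in m′ , old f0<m r
  where
  tail-earlier : ∀ x {y} → m ≤ y → y < f (suc x) → ∃[ x′ ] x′ Fin.< x × f (suc x′) ≡ y
  tail-earlier x m≤y y< with earlier (suc x) m≤y y<
  ... | zero   , _       , refl = contradiction f0<m (≤⇒≯ m≤y)
  ... | suc x′ , s≤s x′< , eq   = x′ , x′< , eq
... | tri≈ _ refl _ = let m′ , r = rg-tabulate (f ∘ suc) (suc m) tail-earlier in m′ , new r
  where
  tail-earlier : ∀ x {y} → suc m ≤ y → y < f (suc x) → ∃[ x′ ] x′ Fin.< x × f (suc x′) ≡ y
  tail-earlier x m<y y< with earlier (suc x) (<⇒≤ m<y) y<
  ... | zero   , _       , refl = contradiction m<y (n≮n _)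
  ... | suc x′ , s≤s x′< , eq   = x′ , x′< , eq
-- A first value above `m` would require `m` to occur before the first position.
... | tri> _ _ m<f0 with () ← proj₁ (proj₂ (earlier zero ≤-refl m<f0))

rg-earlier : ∀ {w m m′} → RestrictedGrowth m w m′ → ∀ x {y} → m ≤ y → y < lookup w x →
             ∃[ x′ ] x′ Fin.< x × lookup w x′ ≡ y
rg-earlier (old p r) zero    m≤y y< = contradiction (<-trans y< p) (≤⇒≯ m≤y)
rg-earlier (old p r) (suc x) m≤y y< with x′ , x′< , eq ← rg-earlier r x m≤y y< =
  suc x′ , s≤s x′< , eq
rg-earlier (new r)   zero    m≤y y< = contradiction y< (≤⇒≯ m≤y)
rg-earlier (new r)   (suc x) m≤y y< with m≤n⇒m<n∨m≡n m≤y
... | inj₂ refl = zero , s≤s z≤n , refl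
... | inj₁ m<y with x′ , x′< , eq ← rg-earlier r x m<y y< = suc x′ , s≤s x′< , eq

-- If `x` lies in block j and i < j, then the minimum of block i precedes the minimum of block j,
-- hence also `x`. So each smaller index has occurred before `x`.
partition-growth : ∀ {n} (P : SetPartition n) →
                   ∃[ m ] RestrictedGrowth 0 (tabulate (toℕ ∘ proj₁ ∘ SetPartition.cover P)) m
partition-growth {n} P = rg-tabulate _ 0 λ x _ → earlier x
  where
  open SetPartition P
  blockOf : Fin n → ℕ
  blockOf = toℕ ∘ proj₁ ∘ cover
  earlier′ : ∀ x i → i Fin.< proj₁ (cover x) → ∃[ x′ ] x′ Fin.< x × blockOf x′ ≡ toℕ i
  earlier′ x i i<j with x₀ , min-x₀ ← minimum _ (nonempty (proj₁ (cover x)))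
    | x′ , min-x′ ← minimum _ (nonempty i)
    = x′ , <-≤-trans (ordered i<j min-x′ min-x₀) (proj₂ min-x₀ x (proj₂ (cover x)))
         , cong toℕ (disjoint (proj₂ (cover x′)) (proj₁ min-x′))
  earlier : ∀ x {y} → y < blockOf x → ∃[ x′ ] x′ Fin.< x × blockOf x′ ≡ y
  earlier x {y} y<j = subst (λ z → ∃[ x′ ] x′ Fin.< x × blockOf x′ ≡ z) toℕ-i
    (earlier′ x (fromℕ< y<size) (subst (_< blockOf x) (sym toℕ-i) y<j))
    where
    y<size = <-trans y<j (toℕ<n (proj₁ (cover x)))
    toℕ-i = toℕ-fromℕ< y<size

does-true : ∀ {A : Set} (a? : Dec A) → does a? ≡ true → A
does-true (yes a) _ = a

module _ (w : Word) (m : ℕ) (r : RestrictedGrowth 0 w m) where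

  private
    class : Fin m → Subset (length w)
    class j = Vec.tabulate λ x → does (lookup w x ≟ toℕ j)

    ∈-class⁺ : ∀ {x j} → lookup w x ≡ toℕ j → x ∈ˢ class j
    ∈-class⁺ {x} {j} eq = lookup⇒[]= x _ (trans (lookup∘tabulate _ x) (dec-true (_ ≟ _) eq))

    ∈-class⁻ : ∀ {x j} → x ∈ˢ class j → lookup w x ≡ toℕ j
    ∈-class⁻ {x} x∈ = does-true (_ ≟ _) (trans (sym (lookup∘tabulate _ x)) ([]=⇒lookup x∈))

    bound : ∀ x → lookup w x < m
    bound x = All.lookup (proj₂ (rg-bound r)) (∈-lookup {xs = w} x)

  growth-partition : SetPartition (length w)
  growth-partition = record
    { size     = m
    ; block    = class
    ; nonempty = λ j → let p = rg-used r z≤n (toℕ<n j) in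
                       index p , ∈-class⁺ (sym (lookup-index p))
    ; disjoint = λ p q → toℕ-injective (trans (sym (∈-class⁻ p)) (∈-class⁻ q))
    ; cover    = λ x → fromℕ< (bound x) , ∈-class⁺ (sym (toℕ-fromℕ< (bound x)))
    ; ordered  = ordered
    }
    where
    ordered : ∀ {i j x y} → i Fin.< j → IsMin x (class i) → IsMin y (class j) → x Fin.< y
    ordered {x = x} {y} i<j (_ , least) (y∈ , _)
      with z , z<y , eq ← rg-earlier r y z≤n (subst (_ <_) (sym (∈-class⁻ y∈)) i<j)
      = ≤-<-trans (least z (∈-class⁺ eq)) z<y

  growth-canonicalForm : map suc w ≡ SetPartition.canonicalForm growth-partition
  growth-canonicalForm = begin
    map suc w                                  ≡⟨ cong (map suc) (tabulate-lookup w) ⟨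
    map suc (tabulate (lookup w))              ≡⟨ map-tabulate (lookup w) suc ⟩
    tabulate (suc ∘ lookup w)                  ≡⟨ tabulate-cong (λ x → cong suc (toℕ-fromℕ< (bound x))) ⟨
    SetPartition.canonicalForm growth-partition ∎
    where open ≡-Reasoning

form : Tree → Word
form T = word T 1 2

map-suc-word : ∀ T c f → map suc (word T c f) ≡ word T (suc c) (suc f)
map-suc-word T c f = map-word suc T c f (λ k → sym (+-suc k f))

form-NC : ∀ T → NC (size T) (form T)
form-NC T = subst₂ NC (length-word T 0 1) (map-suc-word T 0 1)
  ((growth-partition _ _ (rg-word T) , growth-canonicalForm _ _ (rg-word T)) ,
   subst NonCrossing (sym (map-suc-word T 0 1))
     (NonCrossing-⊆ (1 ∷ʳ ⊆-refl) (word-nonCrossing T (n<1+n 1))))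

NC-form : ∀ {n π} → NC n π → ∃[ T ] size T ≡ n × π ≡ form T
NC-form ((P , refl) , nc)
  with m , r ← partition-growth P
  with T , eq ← parseFresh _ _ ≤-refl r (All.tabulate λ _ → z≤n)
         (λ a<b p → nc (s≤s a<b) (subst (_ ⊆_) (map-tabulate _ suc) (Sublistₚ.map⁺ suc p)))
  = T , trans (sym (length-word T 0 1)) (trans (cong length (sym eq)) (length-tabulate _))
      , trans (sym (map-tabulate _ suc)) (trans (cong (map suc) eq) (map-suc-word T 0 1))

-- Order isomorphism and occurrences

-- Agree compares two columns of the two-line array formed by two words.
Agree : ℕ × ℕ → ℕ × ℕ → Set
Agree (x , y) (x′ , y′) = (x < x′ ⇔ y < y′) × (x ≡ x′ ⇔ y ≡ y′)

Agree-sym : ∀ {p q} → Agree p q → Agree (swap p) (swap q)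
Agree-sym (l , e) = ⇔-sym l , ⇔-sym e

Agree-refl : ∀ p → Agree p p
Agree-refl (x , y) =
  mk⇔ (λ q → contradiction q (n≮n _)) (λ q → contradiction q (n≮n _)) , mk⇔ (λ _ → refl) (λ _ → refl)

Agree-< : ∀ {x y x′ y′} → x < x′ → y < y′ → Agree (x , y) (x′ , y′)
Agree-< p q = mk⇔ (λ _ → q) (λ _ → p) ,
  mk⇔ (λ { refl → contradiction p (n≮n _) }) (λ { refl → contradiction q (n≮n _) })

Agree-> : ∀ {x y x′ y′} → x′ < x → y′ < y → Agree (x , y) (x′ , y′)
Agree-> p q = mk⇔ (λ r → contradiction r (<⇒≯ p)) (λ r → contradiction r (<⇒≯ q)) ,
  mk⇔ (λ { refl → contradiction p (n≮n _) }) (λ { refl → contradiction q (n≮n _) })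

StrictlyMonotone : (ℕ → ℕ) → Set
StrictlyMonotone φ = ∀ {x y} → x < y → φ x < φ y

mono-< : ∀ {φ} → StrictlyMonotone φ → ∀ x y → x < y ⇔ φ x < φ y
mono-< {φ} mono x y = mk⇔ mono λ p → ≰⇒> λ y≤x →
  Sum.[ (λ y<x → <⇒≯ p (mono y<x)) , (λ { refl → n≮n _ p }) ] (m≤n⇒m<n∨m≡n y≤x)

mono-≡ : ∀ {φ} → StrictlyMonotone φ → ∀ x y → x ≡ y ⇔ φ x ≡ φ y
mono-≡ {φ} mono x y = mk⇔ (cong φ) inj
  where
  inj : φ x ≡ φ y → x ≡ y
  inj eq with <-cmp x y
  ... | tri< p _ _ = contradiction eq (<⇒≢ (mono p))
  ... | tri≈ _ p _ = p
  ... | tri> _ _ p = contradiction (sym eq) (<⇒≢ (mono p))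

Agree-map : ∀ {φ} → StrictlyMonotone φ → ∀ p q → Agree p q ⇔ Agree (map₁ φ p) (map₁ φ q)
Agree-map mono (x , _) (x′ , _) = mk⇔
  (λ (l , e) → l ⇔-∘ ⇔-sym (mono-< mono x x′) , e ⇔-∘ ⇔-sym (mono-≡ mono x x′))
  (λ (l , e) → l ⇔-∘ mono-< mono x x′ , e ⇔-∘ mono-≡ mono x x′)

Coherent : List (ℕ × ℕ) → Set
Coherent ps = ∀ {p q} → p ∈ ps → q ∈ ps → Agree p q

-- Order isomorphism as a list of columns, free of indices and `cast`: splitting, joining and
-- relabelling the words become list operations on `ps`.
Iso : Word → Word → Set
Iso u v = ∃[ ps ] map proj₁ ps ≡ u × map proj₂ ps ≡ v × Coherent ps

tabulate-lookup-cast : ∀ {n} (v : Word) (eq : n ≡ length v) → tabulate (lookup v ∘ cast eq) ≡ v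
tabulate-lookup-cast v refl = trans (tabulate-cong (cong (lookup v) ∘ cast-is-id refl)) (tabulate-lookup v)

lookup-∈-pairs : ∀ (ps : List (ℕ × ℕ)) (eq : length (map proj₁ ps) ≡ length (map proj₂ ps)) i →
                 (lookup (map proj₁ ps) i , lookup (map proj₂ ps) (cast eq i)) ∈ ps
lookup-∈-pairs (p ∷ ps) eq zero    = here refl
lookup-∈-pairs (p ∷ ps) eq (suc i) = there (lookup-∈-pairs ps (suc-injective eq) i)

orderIsomorphic⇔iso : ∀ u v → OrderIsomorphic u v ⇔ Iso u v
orderIsomorphic⇔iso u v = mk⇔ fwd bwd
  where
  fwd : OrderIsomorphic u v → Iso u v
  fwd (eq , agree) = tabulate column , trans (map-tabulate column proj₁) (tabulate-lookup u)
    , trans (map-tabulate column proj₂) (tabulate-lookup-cast v eq) , coherent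
    where
    column : Fin (length u) → ℕ × ℕ
    column i = lookup u i , lookup v (cast eq i)
    coherent : Coherent (tabulate column)
    coherent p∈ q∈ with i , refl ← ∈-tabulate⁻ p∈ | j , refl ← ∈-tabulate⁻ q∈ = agree i j
  bwd : Iso u v → OrderIsomorphic u v
  bwd (ps , refl , refl , coherent) = eq ,
    λ i j → coherent (lookup-∈-pairs ps eq i) (lookup-∈-pairs ps eq j)
    where
    eq : length (map proj₁ ps) ≡ length (map proj₂ ps)
    eq = trans (length-map proj₁ ps) (sym (length-map proj₂ ps))

iso? : ∀ u v → Dec (Iso u v)
iso? u v = map′ (to (orderIsomorphic⇔iso u v)) (from (orderIsomorphic⇔iso u v)) (orderIsomorphic? u v)

iso-length : ∀ {u v} → Iso u v → length u ≡ length v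
iso-length (ps , refl , refl , _) = trans (length-map proj₁ ps) (sym (length-map proj₂ ps))

iso-sym : ∀ {u v} → Iso u v → Iso v u
iso-sym (ps , refl , refl , coherent) = map swap ps , sym (map-∘ ps) , sym (map-∘ ps) , coherent′
  where
  coherent′ : Coherent (map swap ps)
  coherent′ p∈ q∈ with p , p∈′ , refl ← ∈-map⁻ swap p∈ | q , q∈′ , refl ← ∈-map⁻ swap q∈ =
    Agree-sym {p} {q} (coherent p∈′ q∈′)

iso-refl : ∀ u → Iso u u
iso-refl u = map (λ x → x , x) u , trans (sym (map-∘ u)) (map-id u)
  , trans (sym (map-∘ u)) (map-id u) , coherent
  where
  coherent : Coherent (map (λ x → x , x) u)
  coherent p∈ q∈ with x , _ , refl ← ∈-map⁻ _ p∈ | y , _ , refl ← ∈-map⁻ _ q∈ = mk⇔ id id , mk⇔ id id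

iso-mapˡ⁺ : ∀ {φ u v} → StrictlyMonotone φ → Iso u v → Iso (map φ u) v
iso-mapˡ⁺ {φ} mono (ps , refl , refl , coherent) =
  map (map₁ φ) ps , trans (sym (map-∘ ps)) (map-∘ ps) , sym (map-∘ ps) , coherent′
  where
  coherent′ : Coherent (map (map₁ φ) ps)
  coherent′ p∈ q∈ with p , p∈′ , refl ← ∈-map⁻ _ p∈ | q , q∈′ , refl ← ∈-map⁻ _ q∈ =
    to (Agree-map mono p q) (coherent p∈′ q∈′)

unmap-pairs : ∀ (φ : ℕ → ℕ) u (ps : List (ℕ × ℕ)) → map proj₁ ps ≡ map φ u →
              ∃[ qs ] ps ≡ map (map₁ φ) qs × map proj₁ qs ≡ u
unmap-pairs φ []      []             refl = [] , refl , refl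
unmap-pairs φ (x ∷ u) ((x′ , y) ∷ ps) eq
  with refl , eq′ ← ∷-injective eq
  with qs , refl , refl ← unmap-pairs φ u ps eq′ = (x , y) ∷ qs , refl , refl

iso-mapˡ⁻ : ∀ {φ u v} → StrictlyMonotone φ → Iso (map φ u) v → Iso u v
iso-mapˡ⁻ {φ} {u} mono (ps , eq , refl , coherent)
  with qs , refl , refl ← unmap-pairs φ u ps eq
  = qs , refl , map-∘ qs , λ {p} {q} p∈ q∈ →
      from (Agree-map mono p q) (coherent (∈-map⁺ _ p∈) (∈-map⁺ _ q∈))

iso-mapʳ⁺ : ∀ {φ u v} → StrictlyMonotone φ → Iso u v → Iso u (map φ v)
iso-mapʳ⁺ mono = iso-sym ∘ iso-mapˡ⁺ mono ∘ iso-sym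

iso-mapʳ⁻ : ∀ {φ u v} → StrictlyMonotone φ → Iso u (map φ v) → Iso u v
iso-mapʳ⁻ mono = iso-sym ∘ iso-mapˡ⁻ mono ∘ iso-sym

-- The hypothesis on j < m says that the letters used so far correspond to themselves.
growth-iso-pairs : ∀ {m m₁ m₂} ps → RestrictedGrowth m (map proj₁ ps) m₁ →
                   RestrictedGrowth m (map proj₂ ps) m₂ → Coherent ps →
                   (∀ {j p} → j < m → p ∈ ps → proj₁ p ≡ j ⇔ proj₂ p ≡ j) →
                   map proj₁ ps ≡ map proj₂ ps
growth-iso-pairs []       _ _ _ _ = refl
growth-iso-pairs (p ∷ ps) (old x<m r) s coherent used with from-used ← to (used x<m (here refl)) refl | s
... | old _ s′ = cong₂ _∷_ (sym from-used)
  (growth-iso-pairs ps r s′ (λ p∈ q∈ → coherent (there p∈) (there q∈)) (λ j<m → used j<m ∘ there))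
... | new _    = contradiction (sym from-used) (<⇒≢ x<m)
growth-iso-pairs (p ∷ ps) (new r) (old y<m s) coherent used =
  contradiction (sym (from (used y<m (here refl)) refl)) (<⇒≢ y<m)
growth-iso-pairs {m} (p ∷ ps) (new r) (new s) coherent used = cong (m ∷_)
  (growth-iso-pairs ps r s (λ p∈ q∈ → coherent (there p∈) (there q∈)) used′)
  where
  used′ : ∀ {j q} → j < suc m → q ∈ ps → proj₁ q ≡ j ⇔ proj₂ q ≡ j
  used′ j<m+1 q∈ with m≤n⇒m<n∨m≡n (s≤s⁻¹ j<m+1)
  ... | inj₁ j<m  = used j<m (there q∈)
  ... | inj₂ refl = proj₂ (coherent (there q∈) (here refl))

growth-iso : ∀ {u v m₁ m₂} → RestrictedGrowth 0 u m₁ → RestrictedGrowth 0 v m₂ → Iso u v → u ≡ v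
growth-iso r s (ps , refl , refl , coherent) = growth-iso-pairs ps r s coherent (λ ())

relabel : ℕ → ℕ → ℕ → ℕ
relabel c f zero    = c
relabel c f (suc j) = j + f

relabel-mono : ∀ {c f} → c < f → StrictlyMonotone (relabel c f)
relabel-mono {f = f} c<f {zero}  {suc y} _       = <-≤-trans c<f (m≤n+m f y)
relabel-mono {f = f} c<f {suc x} {suc y} (s≤s p) = +-monoˡ-< f p

-- For `c < f` every word of `T` is thus an increasing relabelling of the normalised `word T 0 1`,
-- so statistics that respect order isomorphism depend on `T` alone.
relabel-word : ∀ T c f → map (relabel c f) (word T 0 1) ≡ word T c f
relabel-word T c f = map-word (relabel c f) T 0 1 λ k → cong (relabel c f) (+-comm k 1)

-- Counting occurrences along suffixes

ind : ∀ {A : Set} → Dec A → ℕ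
ind (true  because _) = 1
ind (false because _) = 0

ind-yes : ∀ {A : Set} (a? : Dec A) → A → ind a? ≡ 1
ind-yes (yes _) a = refl
ind-yes (no ¬a) a = contradiction a ¬a

ind-no : ∀ {A : Set} (a? : Dec A) → ¬ A → ind a? ≡ 0
ind-no (yes a) ¬a = contradiction a ¬a
ind-no (no _)  ¬a = refl

ind-⇔ : ∀ {A B : Set} (a? : Dec A) (b? : Dec B) → A ⇔ B → ind a? ≡ ind b?
ind-⇔ a? (yes b) e = ind-yes a? (from e b)
ind-⇔ a? (no ¬b) e = ind-no a? (¬b ∘ to e)

ind-× : ∀ {A B C : Set} (a? : Dec A) (b? : Dec B) (c? : Dec C) → A ⇔ (B × C) → ind a? ≡ ind b? * ind c?
ind-× a? (yes b) (yes c) e = ind-yes a? (from e (b , c))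
ind-× a? (yes b) (no ¬c) e = ind-no a? (¬c ∘ proj₂ ∘ to e)
ind-× a? (no ¬b) c?      e = ind-no a? (¬b ∘ proj₁ ∘ to e)

-- A structural substitute for `μ`. It also tries the truncated windows near the end, but these are
-- too short to match and contribute 0.
occurrences : Word → Word → ℕ
occurrences τ []        = 0
occurrences τ s@(_ ∷ s′) = ind (iso? (take (length τ) s) τ) + occurrences τ s′

take-short : ∀ {k} {s : Word} → length s < k → length (take k s) < k
take-short {k} {s} p = subst (_< k) (sym (trans (length-take k s) (m≥n⇒m⊓n≡n (<⇒≤ p)))) p

occurrences-short : ∀ τ s → length s < length τ → occurrences τ s ≡ 0
occurrences-short τ []       _ = refl
occurrences-short τ (x ∷ s) p = cong₂ _+_
  (ind-no (iso? _ τ) (λ i → <⇒≢ (take-short {s = x ∷ s} p) (iso-length i)))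
  (occurrences-short τ s (<⇒≤ p))

length-filter-map : ∀ {P : ℕ → Set} (P? : ∀ i → Dec (P i)) (f : ℕ → ℕ) xs →
                    length (filter P? (map f xs)) ≡ length (filter (P? ∘ f) xs)
length-filter-map P? f [] = refl
length-filter-map P? f (x ∷ xs) with does (P? (f x))
... | true  = cong suc (length-filter-map P? f xs)
... | false = length-filter-map P? f xs

length-filter-∷ : ∀ {A : Set} {P : A → Set} (P? : ∀ i → Dec (P i)) x xs →
                  length (filter P? (x ∷ xs)) ≡ ind (P? x) + length (filter P? xs)
length-filter-∷ P? x xs with P? x
... | true  because _ = refl
... | false because _ = refl

-- An empty pattern has to be excluded: `μ` would count it once more, after the last letter.
μ≡occurrences : ∀ τ σ → 0 < length τ → μ τ σ ≡ occurrences τ σ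
μ≡occurrences τ@(_ ∷ τ′) [] _ rewrite 0∸n≡0 (length τ′) = refl
μ≡occurrences τ@(_ ∷ τ′) (x ∷ σ) 0<τ with length τ′ ≤? length σ
... | no ¬p rewrite m≤n⇒m∸n≡0 (≰⇒> ¬p) = sym (occurrences-short τ (x ∷ σ) (s≤s (≰⇒> ¬p)))
... | yes p rewrite +-∸-assoc 1 p = begin
  length (filter match? (0 ∷ applyUpTo suc (length σ ∸ length τ′)))
    ≡⟨ length-filter-∷ match? 0 _ ⟩
  ind (match? 0) + length (filter match? (applyUpTo suc (length σ ∸ length τ′)))
    ≡⟨ cong₂ _+_ (ind-⇔ (match? 0) (iso? _ τ) (orderIsomorphic⇔iso _ τ))
         (cong (length ∘ filter match?) (sym (map-upTo suc (length σ ∸ length τ′)))) ⟩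
  ind (iso? (take (length τ) (x ∷ σ)) τ) + length (filter match? (map suc (upTo (length σ ∸ length τ′))))
    ≡⟨ cong (ind (iso? (take (length τ) (x ∷ σ)) τ) +_)
         (trans (length-filter-map match? suc (upTo (length σ ∸ length τ′))) (μ≡occurrences τ σ 0<τ)) ⟩
  occurrences τ (x ∷ σ) ∎
  where
  open ≡-Reasoning
  match? : ∀ i → Dec (OrderIsomorphic (take (length τ) (drop i (x ∷ σ))) τ)
  match? i = orderIsomorphic? (take (length τ) (drop i (x ∷ σ))) τ

occurrences-map : ∀ {φ} → StrictlyMonotone φ → ∀ τ s → occurrences τ (map φ s) ≡ occurrences τ s
occurrences-map mono τ [] = refl
occurrences-map {φ} mono τ (x ∷ s) = cong₂ _+_
  (ind-⇔ (iso? _ τ) (iso? _ τ) (subst (λ w → Iso w τ ⇔ Iso (take (length τ) (x ∷ s)) τ)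
    (sym (take-map (length τ) (x ∷ s))) (mk⇔ (iso-mapˡ⁻ mono) (iso-mapˡ⁺ mono))))
  (occurrences-map mono τ s)

isoSuffixes : Word → Word → ℕ
isoSuffixes ρ []         = 0
isoSuffixes ρ s@(_ ∷ s′) = ind (iso? s ρ) + isoSuffixes ρ s′

isoSuffixes-map : ∀ {φ} → StrictlyMonotone φ → ∀ ρ s → isoSuffixes ρ (map φ s) ≡ isoSuffixes ρ s
isoSuffixes-map mono ρ []      = refl
isoSuffixes-map mono ρ (x ∷ s) = cong₂ _+_
  (ind-⇔ (iso? _ ρ) (iso? _ ρ) (mk⇔ (iso-mapˡ⁻ mono) (iso-mapˡ⁺ mono)))
  (isoSuffixes-map mono ρ s)

occurrences-word : ∀ τ T {c f} → c < f → occurrences τ (word T c f) ≡ occurrences τ (form T)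
occurrences-word τ T {c} {f} c<f = trans (base c<f) (sym (base (n<1+n 1)))
  where
  base : ∀ {c f} → c < f → occurrences τ (word T c f) ≡ occurrences τ (word T 0 1)
  base {c} {f} c<f = trans (cong (occurrences τ) (sym (relabel-word T c f)))
                       (occurrences-map (relabel-mono c<f) τ (word T 0 1))

isoSuffixes-word : ∀ ρ T {c f} → c < f → isoSuffixes ρ (word T c f) ≡ isoSuffixes ρ (form T)
isoSuffixes-word ρ T {c} {f} c<f = trans (base c<f) (sym (base (n<1+n 1)))
  where
  base : ∀ {c f} → c < f → isoSuffixes ρ (word T c f) ≡ isoSuffixes ρ (word T 0 1)
  base {c} {f} c<f = trans (cong (isoSuffixes ρ) (sym (relabel-word T c f)))
                       (isoSuffixes-map (relabel-mono c<f) ρ (word T 0 1))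

-- Occurrences of (ρ + 1) 1ᵇ

map-++⁻ : ∀ {A B : Set} (f : A → B) xs ys {zs} → map f xs ≡ ys ++ zs →
          ∃[ xs₁ ] ∃[ xs₂ ] xs ≡ xs₁ ++ xs₂ × map f xs₁ ≡ ys × map f xs₂ ≡ zs
map-++⁻ f xs       []       eq = [] , xs , refl , refl , eq
map-++⁻ f (x ∷ xs) (y ∷ ys) eq
  with refl , eq′ ← ∷-injective eq
  with xs₁ , xs₂ , refl , refl , eq″ ← map-++⁻ f xs ys eq′ = x ∷ xs₁ , xs₂ , refl , refl , eq″

constant-column : ∀ {c} n (ps : List (ℕ × ℕ)) → map proj₂ ps ≡ replicate n 1 →
                  (∀ {p} → p ∈ ps → proj₂ p ≡ 1 → proj₁ p ≡ c) → map proj₁ ps ≡ replicate n c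
constant-column zero    []       _  _ = refl
constant-column (suc n) (p ∷ ps) eq h with eq₁ , eq₂ ← ∷-injective eq =
  cong₂ _∷_ (h (here refl) eq₁) (constant-column n ps eq₂ (h ∘ there))

take-++-≤ : ∀ k {s t : Word} → k ≤ length s → take k (s ++ t) ≡ take k s
take-++-≤ zero                z≤n     = refl
take-++-≤ (suc k) {x ∷ s} (s≤s p) = cong (x ∷_) (take-++-≤ k p)

take-length-++ : ∀ (s : Word) {t} → take (length s) (s ++ t) ≡ s
take-length-++ []      = refl
take-length-++ (x ∷ s) = cong (x ∷_) (take-length-++ s)

data Overlap (s t u v : Word) : Set where
  shorter : ∀ x d → u ≡ s ++ x ∷ d → t ≡ x ∷ d ++ v → Overlap s t u v
  equal   : s ≡ u → t ≡ v → Overlap s t u v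
  longer  : ∀ x d → s ≡ u ++ x ∷ d → v ≡ x ∷ d ++ t → Overlap s t u v

compareSplit : ∀ s {t} u {v} → s ++ t ≡ u ++ v → Overlap s t u v
compareSplit []      []      eq = equal refl eq
compareSplit []      (y ∷ u) eq = shorter y u refl eq
compareSplit (x ∷ s) []      eq = longer x s refl (sym eq)
compareSplit (x ∷ s) (y ∷ u) eq with refl , eq′ ← ∷-injective eq with compareSplit s u eq′
... | shorter z d refl refl = shorter z d refl refl
... | equal refl refl       = equal refl refl
... | longer z d refl refl  = longer z d refl refl

replicate-head : ∀ {c : ℕ} n d {t r} → length d < n → replicate n c ++ r ≡ d ++ t → ∃[ t′ ] t ≡ c ∷ t′
replicate-head (suc n) []      _       eq = _ , sym eq
replicate-head (suc n) (x ∷ d) (s≤s p) eq = replicate-head n d p (∷-injectiveʳ eq)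

module _ (ρ : Word) (positive : All (1 ≤_) ρ) (b : ℕ) where

  -- In the pattern the letter 1 occurs only in the final run and lies below the rest. The columns
  -- over this run therefore share one top letter `c`, which lies below all of `u`.
  window⁻ : ∀ {z} → Iso z pattern[ ρ , suc b ] →
            ∃[ u ] ∃[ c ] z ≡ u ++ replicate (suc b) c × Iso u ρ × All (c <_) u
  window⁻ (ps , refl , eq , coherent)
    with ps₁ , qs , refl , eq₁ , eq₂ ← map-++⁻ proj₂ ps (map suc ρ) eq
    -- The run has length `suc b`, so there is a first column from which to read off `c`.
    with (c , y) ∷ ps₂ ← qs
    with refl ← ∷-injectiveˡ eq₂
    = map proj₁ ps₁ , c
    , trans (map-++ proj₁ ps₁ _) (cong (map proj₁ ps₁ ++_)
        (constant-column (suc b) ((c , 1) ∷ ps₂) eq₂ λ p∈ →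
          from (proj₂ (coherent (∈-++⁺ʳ ps₁ p∈) (∈-++⁺ʳ ps₁ (here refl))))))
    , iso-mapʳ⁻ s≤s (ps₁ , refl , eq₁ , λ p∈ q∈ → coherent (∈-++⁺ˡ p∈) (∈-++⁺ˡ q∈))
    , Allₚ.map⁺ (All.tabulate λ {p} p∈ →
        from (proj₁ (coherent (∈-++⁺ʳ ps₁ (here refl)) (∈-++⁺ˡ p∈)))
          (All.lookup {P = 1 <_} (Allₚ.map⁺ (All.map s≤s positive))
            (subst (proj₂ p ∈_) eq₁ (∈-map⁺ proj₂ p∈))))

  window⁺ : ∀ {u c} → Iso u ρ → All (c <_) u → Iso (u ++ replicate (suc b) c) pattern[ ρ , suc b ]
  window⁺ {c = c} (ps , refl , refl , coherent) c<u = ps₁ ++ ps₂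
    , trans (map-++ proj₁ ps₁ ps₂) (cong₂ _++_ (sym (map-∘ ps)) (map-replicate proj₁ (suc b) (c , 1)))
    , trans (map-++ proj₂ ps₁ ps₂) (cong₂ _++_ (trans (sym (map-∘ ps)) (map-∘ ps)) (map-replicate proj₂ (suc b) (c , 1)))
    , λ p∈ q∈ → agree (∈-++⁻ ps₁ p∈) (∈-++⁻ ps₁ q∈)
    where
    ps₁ ps₂ : List (ℕ × ℕ)
    ps₁ = map (map₂ suc) ps
    ps₂ = replicate (suc b) (c , 1)
    above : ∀ {p} → p ∈ ps → c < proj₁ p × 1 < suc (proj₂ p)
    above p∈ = All.lookup c<u (∈-map⁺ proj₁ p∈) , s≤s (All.lookup positive (∈-map⁺ proj₂ p∈))
    constant : ∀ {p} → p ∈ ps₂ → p ≡ (c , 1)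
    constant = All.lookup {P = _≡ (c , 1)} (Allₚ.replicate⁺ (suc b) refl)
    agree : ∀ {p q} → p ∈ ps₁ ⊎ p ∈ ps₂ → q ∈ ps₁ ⊎ q ∈ ps₂ → Agree p q
    agree (inj₁ p∈) (inj₁ q∈) with p , p∈′ , refl ← ∈-map⁻ _ p∈ | q , q∈′ , refl ← ∈-map⁻ _ q∈ =
      Agree-sym {map₁ suc (swap p)} {map₁ suc (swap q)}
        (to (Agree-map s≤s (swap p) (swap q)) (Agree-sym {p} {q} (coherent p∈′ q∈′)))
    agree (inj₁ p∈) (inj₂ q∈) with p , p∈′ , refl ← ∈-map⁻ _ p∈ | refl ← constant q∈ =
      let l , r = above p∈′ in Agree-> l r
    agree (inj₂ p∈) (inj₁ q∈) with refl ← constant p∈ | q , q∈′ , refl ← ∈-map⁻ _ q∈ =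
      let l , r = above q∈′ in Agree-< l r
    agree (inj₂ p∈) (inj₂ q∈) with refl ← constant p∈ | refl ← constant q∈ = Agree-refl (c , 1)

  private
    τ : Word
    τ = pattern[ ρ , suc b ]

  length-pattern : length τ ≡ length ρ + suc b
  length-pattern = trans (length-++ (map suc ρ)) (cong₂ _+_ (length-map suc ρ) (length-replicate (suc b)))

  StartsWithRun : ℕ → Word → Set
  StartsWithRun c t = ∃[ t′ ] t ≡ replicate (suc b) c ++ t′

  -- The run of the pattern must begin exactly where `t` does. If it began later, the minimal letter
  -- `c` at the head of `t` would have to exceed the letter of the run; if earlier, the run would
  -- contain both a letter of `s` and `c`, which differ.
  straddling⁻ : ∀ {c s t} → All (c <_) s → HeadedBy c t → All (c ≤_) t → length s < length τ →
                Iso (take (length τ) (s ++ t)) τ → Iso s ρ × StartsWithRun c t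
  straddling⁻ {c} {s} {t} c<s h c≤t short i
    with u , c₀ , eq , iu , c₀<u ← window⁻ i
    with rest ← drop (length τ) (s ++ t) | split ← take++drop≡id (length τ) (s ++ t)
    with compareSplit s u (trans (sym split) (trans (cong (_++ rest) eq) (++-assoc u _ rest)))
  ... | equal refl refl with head ← h = iu , rest , refl
  ... | shorter x d refl refl with head ← h =
    contradiction (All.lookup c≤t (∈-++⁺ʳ (c ∷ d) (here refl)))
      (<⇒≱ (All.lookup c₀<u (∈-++⁺ʳ s (here refl))))
  ... | longer x d refl eq′
    with refl ← ∷-injectiveˡ eq′
    with _ , refl ← replicate-head (suc b) (x ∷ d)
           (+-cancelˡ-< (length u) _ _ (subst₂ _<_ (length-++ u)
             (trans length-pattern (cong (_+ suc b) (sym (iso-length iu)))) short)) eq′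
    with head ← h
    = contradiction (All.lookup c<s (∈-++⁺ʳ u (here refl))) (n≮n _)

  straddling⁺ : ∀ {c s t} → All (c <_) s → Iso s ρ → StartsWithRun c t →
                Iso (take (length τ) (s ++ t)) τ
  straddling⁺ {c} {s} c<s i (t′ , refl) = subst (λ z → Iso z τ) (sym eq) (window⁺ i c<s)
    where
    w : Word
    w = s ++ replicate (suc b) c
    length-w : length τ ≡ length w
    length-w = trans length-pattern (trans
      (cong₂ _+_ (sym (iso-length i)) (sym (length-replicate (suc b)))) (sym (length-++ s)))
    eq : take (length τ) (s ++ replicate (suc b) c ++ t′) ≡ w
    eq = trans (cong₂ take length-w (sym (++-assoc s _ t′))) (take-length-++ w)

  -- A window starting at the head of `s` either fits into `s`, and then `s` is too long to be a
  -- copy of `ρ`, or leaves it, and then it matches when `s` is such a copy and `t` starts with the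
  -- run. The second condition is the same for all suffixes of `s`, so it factors out.
  occurrences-++ : ∀ {c t} (run? : Dec (StartsWithRun c t)) → HeadedBy c t → All (c ≤_) t →
                   ∀ s → All (c <_) s →
                   occurrences τ (s ++ t) ≡ occurrences τ s + isoSuffixes ρ s * ind run? + occurrences τ t
  occurrences-++ run? h c≤t [] _ = refl
  occurrences-++ {c} {t} run? h c≤t s@(x ∷ s′) c<s@(_ ∷ c<s′) = begin
    ind (iso? (take (length τ) (s ++ t)) τ) + occurrences τ (s′ ++ t)
      ≡⟨ cong₂ _+_ first (occurrences-++ run? h c≤t s′ c<s′) ⟩
    (p + q * r) + (o + σ * r + o′)
      ≡⟨ solve 6 (λ p q r o σ o′ → (p :+ q :* r) :+ (o :+ σ :* r :+ o′) :=
                     (p :+ o) :+ (q :+ σ) :* r :+ o′) refl p q r o σ o′ ⟩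
    (p + o) + (q + σ) * r + o′ ∎
    where
    open ≡-Reasoning
    open +-*-Solver
    p q r o σ o′ : ℕ
    p = ind (iso? (take (length τ) s) τ)
    q = ind (iso? s ρ)
    r = ind run?
    o = occurrences τ s′
    σ = isoSuffixes ρ s′
    o′ = occurrences τ t
    first : ind (iso? (take (length τ) (s ++ t)) τ) ≡ p + q * r
    first with length τ ≤? length s
    ... | yes long = begin
      ind (iso? (take (length τ) (s ++ t)) τ) ≡⟨ cong (λ z → ind (iso? z τ)) (take-++-≤ (length τ) long) ⟩
      p                                       ≡⟨ +-identityʳ p ⟨
      p + 0 * r                               ≡⟨ cong (λ z → p + z * r) (ind-no (iso? s ρ) too-long) ⟨
      p + q * r                               ∎
      where
      too-long : ¬ Iso s ρ
      too-long i = <⇒≱ (m<m+n (length ρ) (s≤s z≤n)) (subst₂ _≤_ length-pattern (iso-length i) long)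
    ... | no short = trans
      (ind-× _ (iso? s ρ) run? (mk⇔ (straddling⁻ c<s h c≤t (≰⇒> short)) (λ (i , run) → straddling⁺ c<s i run)))
      (cong (_+ q * r) (sym (ind-no (iso? (take (length τ) s) τ)
        λ i → <⇒≢ (take-short {s = s} (≰⇒> short)) (iso-length i))))

  -- As `ρ` is nonempty, a match ends with a letter strictly below its first one, so it cannot start
  -- at a minimal letter.
  occurrences-min : ∀ {c s} → 0 < length ρ → All (c ≤_) s → occurrences τ (c ∷ s) ≡ occurrences τ s
  occurrences-min {c} {s} 0<a c≤s = cong (_+ occurrences τ s) (ind-no (iso? _ τ) no-window)
    where
    no-window : ¬ Iso (take (length τ) (c ∷ s)) τ
    no-window i with window⁻ i
    ... | [] , c₀ , eq , iu , _ = <⇒≢ 0<a (iso-length iu)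
    ... | x ∷ u , c₀ , eq , iu , c₀<x ∷ _ with split ← take++drop≡id (length τ) (c ∷ s)
      with rest ← drop (length τ) (c ∷ s)
      with refl , refl ← ∷-injective (trans (sym (cong (_++ rest) eq)) split)
      = contradiction (All.lookup c≤s (∈-++⁺ˡ (∈-++⁺ʳ u (here refl)))) (<⇒≱ c₀<x)

-- Occurrences in trees

-- The length of the initial run of minimal letters.
lead : Tree → ℕ
lead nil                 = 0
lead (node nil        R) = suc (lead R)
lead (node (node _ _) R) = 1

lead-run⁺ : ∀ n T {c f} → n ≤ lead T → ∃[ t ] word T c f ≡ replicate n c ++ t
lead-run⁺ zero    T                   _       = _ , refl
lead-run⁺ (suc n) (node nil R)        (s≤s p) with t , eq ← lead-run⁺ n R p = t , cong (_ ∷_) eq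
lead-run⁺ (suc zero) (node (node _ _) R) (s≤s p) = _ , refl

lead-run⁻ : ∀ n T {c f t} → c < f → word T c f ≡ replicate n c ++ t → n ≤ lead T
lead-run⁻ zero          T                   _   _  = z≤n
lead-run⁻ (suc n)       (node nil R)        c<f eq = s≤s (lead-run⁻ n R c<f (∷-injectiveʳ eq))
lead-run⁻ (suc zero)    (node (node _ _) R) _   _  = s≤s z≤n
lead-run⁻ (suc (suc n)) (node (node _ _) R) c<f eq =
  contradiction (sym (∷-injectiveˡ (∷-injectiveʳ eq))) (<⇒≢ c<f)

initialOnes-word : ∀ T {f} → 1 < f → initialOnes (word T 1 f) ≡ lead T
initialOnes-word nil                 1<f = refl
initialOnes-word (node nil R)        1<f = cong suc (initialOnes-word R 1<f)
initialOnes-word (node (node _ _) R) (s≤s (s≤s z≤n)) = refl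

stem : ℕ → Tree → Tree
stem zero    T = T
stem (suc b) T = node nil (stem b T)

size-stem : ∀ b T → size (stem b T) ≡ b + size T
size-stem zero    T = refl
size-stem (suc b) T = cong suc (size-stem b T)

stem-injective : ∀ b {T T′} → stem b T ≡ stem b T′ → T ≡ T′
stem-injective zero    eq = eq
stem-injective (suc b) eq = stem-injective b (proj₂ (node-injective eq))

-- The first `b` minima are nodes with empty left subtree; the last required one is the root of the
-- nonempty rest, whose left subtree is arbitrary.
lead-stem : ∀ b T → (suc b ≤ lead T) ⇔ (∃[ T′ ] 0 < size T′ × T ≡ stem b T′)
lead-stem b T = mk⇔ (fwd b T) (λ { (T′ , p , refl) → bwd b T′ p })
  where
  fwd : ∀ b T → suc b ≤ lead T → ∃[ T′ ] 0 < size T′ × T ≡ stem b T′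
  fwd zero    T@(node _ _)        _       = T , s≤s z≤n , refl
  fwd (suc b) (node nil R)        (s≤s p) with T′ , q , eq ← fwd b R p = T′ , q , cong (node nil) eq
  fwd (suc b) (node (node _ _) R) (s≤s ())
  bwd : ∀ b T′ → 0 < size T′ → suc b ≤ lead (stem b T′)
  bwd zero    (node nil R)        _ = s≤s z≤n
  bwd zero    (node (node _ _) R) _ = s≤s z≤n
  bwd (suc b) T′                  p = s≤s (bwd b T′ p)

-- Graft P T T′: replacing by P the leaf of T that contributes the last letter of its
-- word gives T′.
data Graft (P : Tree) : Tree → Tree → Set where
  here  : Graft P (node nil nil) P
  left  : ∀ {L L′} → Graft P L L′ → Graft P (node L nil) (node L′ nil)
  right : ∀ {L R R′} → Graft P R R′ → Graft P (node L R) (node L R′)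

-- The relation `Graft` serves for inductions; sums over an image need a map. The default `nil` at
-- `nil` keeps this map injective, since for nonempty `P` all other values are nonempty.
graft : Tree → Tree → Tree
graft P nil                     = nil
graft P (node nil nil)          = P
graft P (node L@(node _ _) nil) = node (graft P L) nil
graft P (node L R@(node _ _))   = node L (graft P R)

graft-Graft : ∀ P T → 0 < size T → Graft P T (graft P T)
graft-Graft P (node nil nil)          _ = here
graft-Graft P (node L@(node _ _) nil) _ = left (graft-Graft P L (s≤s z≤n))
graft-Graft P (node nil R@(node _ _)) _ = right (graft-Graft P R (s≤s z≤n))
graft-Graft P (node (node _ _) R@(node _ _)) _ = right (graft-Graft P R (s≤s z≤n))

graft-source : ∀ {P T T′} → Graft P T T′ → 0 < size T
graft-source here      = s≤s z≤n
graft-source (left _)  = s≤s z≤n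
graft-source (right _) = s≤s z≤n

graft-functional : ∀ {P T T₁ T₂} → Graft P T T₁ → Graft P T T₂ → T₁ ≡ T₂
graft-functional here      here      = refl
graft-functional (left g)  (left h)  = cong (λ L → node L nil) (graft-functional g h)
graft-functional (right g) (right h) = cong (node _) (graft-functional g h)

isoSuffixes-short : ∀ ρ s → length s < length ρ → isoSuffixes ρ s ≡ 0
isoSuffixes-short ρ []      _ = refl
isoSuffixes-short ρ (x ∷ s) p = cong₂ _+_
  (ind-no (iso? _ ρ) (λ i → <⇒≢ p (iso-length i))) (isoSuffixes-short ρ s (<⇒≤ p))

-- Isomorphic words have equal length, and all shorter suffixes fail once one suffix has matched.
isoSuffixes≤1 : ∀ ρ s → isoSuffixes ρ s ≤ 1
isoSuffixes≤1 ρ [] = z≤n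
isoSuffixes≤1 ρ (x ∷ s) with iso? (x ∷ s) ρ
... | no _  = isoSuffixes≤1 ρ s
... | yes i = s≤s (≤-reflexive (isoSuffixes-short ρ s (≤-reflexive (iso-length i))))

word-≥-current : ∀ T {c f} → c < f → All (c ≤_) (word T c f)
word-≥-current T c<f = All.map (λ { (inj₁ refl) → ≤-refl ; (inj₂ p) → ≤-trans (<⇒≤ c<f) p }) (word-≥ T)

iso-word : ∀ T P {c f} → c < f → Iso (word T c f) (form P) ⇔ T ≡ P
iso-word T P {c} {f} c<f = mk⇔ fwd bwd
  where
  fwd : Iso (word T c f) (form P) → T ≡ P
  fwd i = word-injective T P (n<1+n 0) (growth-iso (rg-word T) (rg-word P)
    (iso-mapˡ⁻ (relabel-mono c<f) (iso-mapʳ⁻ (relabel-mono (n<1+n 1))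
      (subst₂ Iso (sym (relabel-word T c f)) (sym (relabel-word P 1 2)) i))))
  bwd : T ≡ P → Iso (word T c f) (form P)
  bwd refl = subst₂ Iso (relabel-word T c f) (relabel-word T 1 2)
    (iso-mapˡ⁺ (relabel-mono c<f) (iso-mapʳ⁺ (relabel-mono (n<1+n 1)) (iso-refl _)))

module _ (PL PR : Tree) (b : ℕ) where

  private
    P : Tree
    P = node PL PR

    ρ τ : Word
    ρ = form P
    τ = pattern[ ρ , suc b ]

  occ : Tree → ℕ
  occ T = occurrences τ (form T)

  suffixes : Tree → ℕ
  suffixes T = isoSuffixes ρ (form T)

  private
    positive : All (1 ≤_) ρ
    positive = word-≥-current P (n<1+n 1)

    length-τ : length τ ≡ size P + suc b
    length-τ = trans (length-pattern ρ positive b) (cong (_+ suc b) (length-word P 1 2))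

  -- No window starts at the minimal letter of the node. What follows has the shape that
  -- `occurrences-++` asks for: `L` lies strictly above 1, and `R` is empty or begins with 1.
  occ-node : ∀ L R → occ (node L R) ≡ occ L + suffixes L * ind (suc b ≤? lead R) + occ R
  occ-node L R = begin
    occurrences τ (1 ∷ wL ++ wR)
      ≡⟨ occurrences-min ρ positive b (s≤s z≤n)
           (Allₚ.++⁺ (All.map <⇒≤ 1<wL) 1≤wR) ⟩
    occurrences τ (wL ++ wR)
      ≡⟨ occurrences-++ ρ positive b run? (word-headed R) 1≤wR wL 1<wL ⟩
    occurrences τ wL + isoSuffixes ρ wL * ind run? + occurrences τ wR
      ≡⟨ cong₂ _+_ (cong₂ _+_ (occurrences-word τ L (n<1+n 2))
            (cong₂ _*_ (isoSuffixes-word ρ L (n<1+n 2)) (ind-⇔ run? (suc b ≤? lead R) run⇔)))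
           (occurrences-word τ R 1<f) ⟩
    occ L + suffixes L * ind (suc b ≤? lead R) + occ R ∎
    where
    open ≡-Reasoning
    wL wR : Word
    wL = word L 2 3
    wR = word R 1 (blocks L + 2)
    1<f : 1 < blocks L + 2
    1<f = m≤n+m 2 (blocks L)
    1<wL : All (1 <_) wL
    1<wL = word-fresh-≥ L
    1≤wR : All (1 ≤_) wR
    1≤wR = word-≥-current R 1<f
    run⇔ : StartsWithRun ρ positive b 1 wR ⇔ suc b ≤ lead R
    run⇔ = mk⇔ (λ (t , eq) → lead-run⁻ (suc b) R 1<f eq) (lead-run⁺ (suc b) R)
    run? : Dec (StartsWithRun ρ positive b 1 wR)
    run? = Dec.map (⇔-sym run⇔) (suc b ≤? lead R)

  private
    -- `ρ` begins with its least letter 1. It follows that a copy of `ρ` ending the word can only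
    -- start at a node on the path to the last letter, which makes such copies grafted subtrees.
    no-descent : ∀ {c x s t} → c < x → ¬ Iso (x ∷ s ++ c ∷ t) ρ
    no-descent {c} {x} {s} c<x (p@(_ , y) ∷ ps , eq₁ , eq₂ , coherent)
      with refl , eq₁′ ← ∷-injective eq₁ | refl , eq₂′ ← ∷-injective eq₂
      with (_ , z) , q∈ , refl ← ∈-map⁻ proj₁ (subst (c ∈_) (sym eq₁′) (∈-++⁺ʳ s (here refl)))
      = <⇒≱ (to (proj₁ (coherent (there q∈) (here refl))) c<x)
            (All.lookup positive (there (subst (z ∈_) eq₂′ (∈-map⁺ proj₂ q∈))))

    isoSuffixes-++ : ∀ {c t} s → All (c <_) s → isoSuffixes ρ (s ++ c ∷ t) ≡ isoSuffixes ρ (c ∷ t)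
    isoSuffixes-++ []      _           = refl
    isoSuffixes-++ (x ∷ s) (c<x ∷ c<s) =
      cong₂ _+_ (ind-no (iso? _ ρ) (no-descent {s = s} c<x)) (isoSuffixes-++ s c<s)

  suffixes-node-nil : ∀ L → suffixes (node L nil) ≡ ind (iso? (form (node L nil)) ρ) + suffixes L
  suffixes-node-nil L = cong (ind (iso? (form (node L nil)) ρ) +_)
    (trans (cong (isoSuffixes ρ) (++-identityʳ (word L 2 3))) (isoSuffixes-word ρ L (n<1+n 2)))

  suffixes-node-node : ∀ L R → 0 < size R →
                       suffixes (node L R) ≡ ind (iso? (form (node L R)) ρ) + suffixes R
  suffixes-node-node L R@(node _ _) _ = cong (ind (iso? (form (node L R)) ρ) +_)
    (trans (isoSuffixes-++ (word L 2 3) (word-fresh-≥ L)) (isoSuffixes-word ρ R (m≤n+m 2 (blocks L))))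

  suffixes-whole : 1 ≤ suffixes P
  suffixes-whole = ≤-trans (≤-reflexive (sym (ind-yes (iso? ρ ρ) (iso-refl ρ)))) (m≤m+n _ _)

  -- One node gives way to the nodes of `P`, a gain of `size P` minus 1.
  size-graft : ∀ {T T′} → Graft P T T′ → size T′ ≡ (size PL + size PR) + size T
  size-graft here = sym (+-comm _ 1)
  size-graft (left {L} {L′} g) = begin
    suc (size L′ + 0)                        ≡⟨ cong (λ n → suc (n + 0)) (size-graft g) ⟩
    suc (size PL + size PR + size L + 0)     ≡⟨ cong suc (+-assoc (size PL + size PR) (size L) 0) ⟩
    suc (size PL + size PR + (size L + 0))   ≡⟨ +-suc (size PL + size PR) (size L + 0) ⟨
    (size PL + size PR) + suc (size L + 0)   ∎
    where open ≡-Reasoning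
  size-graft (right {L} {R} {R′} g) = trans (cong (λ n → suc (size L + n)) (size-graft g))
    (solve 3 (λ l p r → con 1 :+ (l :+ (p :+ r)) := p :+ (con 1 :+ (l :+ r))) refl
      (size L) (size PL + size PR) (size R))
    where open +-*-Solver

  graft-target : ∀ {T T′} → Graft P T T′ → 0 < size T′
  graft-target g = <-≤-trans (graft-source g) (≤-trans (m≤n+m _ _) (≤-reflexive (sym (size-graft g))))

  -- By `size-graft` the two sources have equal size, so a leaf cannot compete with a larger tree. A
  -- graft on the left and one on the right differ in whether the right subtree of the result is
  -- empty.
  graft-injective : ∀ {T₁ T₂ T′} → Graft P T₁ T′ → Graft P T₂ T′ → T₁ ≡ T₂
  graft-injective g h = go g h (+-cancelˡ-≡ _ _ _ (trans (sym (size-graft g)) (size-graft h)))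
    where
    go : ∀ {T₁ T₂ T′} → Graft P T₁ T′ → Graft P T₂ T′ → size T₁ ≡ size T₂ → T₁ ≡ T₂
    go here      here      _  = refl
    go here      (left h)  eq = contradiction (suc-injective eq) (<⇒≢ (≤-trans (graft-source h) (m≤m+n _ _)))
    go here      (right h) eq = contradiction (suc-injective eq) (<⇒≢ (≤-trans (graft-source h) (m≤n+m _ _)))
    go (left g)  here      eq = contradiction (suc-injective (sym eq)) (<⇒≢ (≤-trans (graft-source g) (m≤m+n _ _)))
    go (right g) here      eq = contradiction (suc-injective (sym eq)) (<⇒≢ (≤-trans (graft-source g) (m≤n+m _ _)))
    go (left g)  (left h)  _  = cong (λ L → node L nil) (graft-injective g h)
    go (left g)  (right h) _  = contradiction (graft-target h) λ ()
    go (right g) (left h)  _  = contradiction (graft-target g) λ ()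
    go (right g) (right h) _  = cong (node _) (graft-injective g h)

  whole-or-rest : ∀ T {n} → suffixes T ≡ ind (iso? (form T) ρ) + n → 1 ≤ suffixes T → T ≡ P ⊎ 1 ≤ n
  whole-or-rest T eq p with iso? (form T) ρ
  ... | yes i = inj₁ (to (iso-word T P (n<1+n 1)) i)
  ... | no _  = inj₂ (subst (1 ≤_) eq p)

  suffixes⇒graft : ∀ T → 1 ≤ suffixes T → ∃[ T′ ] Graft P T′ T
  suffixes⇒graft (node L nil) p =
    Sum.[ (λ { refl → _ , here }) , (λ q → let _ , g = suffixes⇒graft L q in _ , left g) ]
      (whole-or-rest (node L nil) (suffixes-node-nil L) p)
  suffixes⇒graft (node L R@(node _ _)) p =
    Sum.[ (λ { refl → _ , here }) , (λ q → let _ , g = suffixes⇒graft R q in _ , right g) ]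
      (whole-or-rest (node L R) (suffixes-node-node L R (s≤s z≤n)) p)

  graft⇒suffixes : ∀ {T T′} → Graft P T T′ → 1 ≤ suffixes T′
  graft⇒suffixes here = suffixes-whole
  graft⇒suffixes (left {L′ = L′} g) = ≤-trans (graft⇒suffixes g)
    (≤-trans (m≤n+m _ _) (≤-reflexive (sym (suffixes-node-nil L′))))
  graft⇒suffixes (right {L} {R′ = R′} g) = ≤-trans (graft⇒suffixes g)
    (≤-trans (m≤n+m _ _) (≤-reflexive (sym (suffixes-node-node L R′ (graft-target g)))))

  suffixes-graft : ∀ T → 1 ≤ suffixes T ⇔ (∃[ T′ ] 0 < size T′ × T ≡ graft P T′)
  suffixes-graft T = mk⇔
    (λ p → let T′ , g = suffixes⇒graft T p in
           T′ , graft-source g , graft-functional g (graft-Graft P T′ (graft-source g)))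
    (λ { (T′ , p , refl) → graft⇒suffixes (graft-Graft P T′ p) })

  suffixes-ind : ∀ T → suffixes T ≡ ind (1 ≤? suffixes T)
  suffixes-ind T = lemma (suffixes T) (isoSuffixes≤1 ρ (form T))
    where
    lemma : ∀ n → n ≤ 1 → n ≡ ind (1 ≤? n)
    lemma zero          _ = refl
    lemma (suc zero)    _ = refl
    lemma (suc (suc _)) (s≤s ())

  occ-stem : ∀ k T → occ (stem k T) ≡ occ T
  occ-stem zero    T = refl
  occ-stem (suc k) T = trans (occ-node nil (stem k T)) (occ-stem k T)

  occ-leaf : occ (node nil nil) ≡ 0
  occ-leaf = occ-node nil nil

  occ-P : occ P ≡ 0
  occ-P = occurrences-short τ ρ (subst₂ _<_ (sym (length-word P 1 2)) (sym length-τ)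
    (m<m+n (size P) (s≤s z≤n)))

  module _ (single : 2 ≤ suc b → lead P ≡ 1) where

    -- Grafting touches the initial run only when the last letter of `T` belongs to it; that letter
    -- is then replaced by the initial run of `P`, of length 1 if b is positive. For b zero both
    -- sides hold, the trees being nonempty.
    lead-graft : ∀ {T T′} → Graft P T T′ → suc b ≤ lead T ⇔ suc b ≤ lead T′
    lead-graft = go b single
      where
      positive-lead : ∀ T → 0 < size T → 1 ≤ lead T
      positive-lead (node nil _)        _ = s≤s z≤n
      positive-lead (node (node _ _) _) _ = s≤s z≤n
      preserved : lead P ≡ 1 → ∀ {T T′} → Graft P T T′ → lead T ≡ lead T′
      preserved eq here = sym eq
      preserved eq (left {node _ _} {node _ _} g) = refl
      preserved eq (left {node _ _} {nil} g) = contradiction (graft-target g) λ ()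
      preserved eq (right {nil} g) = cong suc (preserved eq g)
      preserved eq (right {node _ _} g) = refl
      go : ∀ b → (2 ≤ suc b → lead P ≡ 1) → ∀ {T T′} → Graft P T T′ → suc b ≤ lead T ⇔ suc b ≤ lead T′
      go zero    single {T} {T′} g = mk⇔
        (λ _ → positive-lead T′ (graft-target g)) (λ _ → positive-lead T (graft-source g))
      go (suc b) single g rewrite preserved (single (s≤s (s≤s z≤n))) g = mk⇔ id id

    -- The product in `occ-node` is safe: `L` changes only when the right subtree is empty and the
    -- product is 0, and a change of `R` is governed by `lead-graft`.
    occ-graft : ∀ {T T′} → Graft P T T′ → occ T′ ≡ occ T
    occ-graft here = trans occ-P (sym occ-leaf)
    occ-graft (left {L} {L′} g) = begin
      occ (node L′ nil)                 ≡⟨ occ-node L′ nil ⟩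
      occ L′ + suffixes L′ * 0 + 0      ≡⟨ cong₂ (λ x y → x + y + 0) (occ-graft g) (*-zeroʳ (suffixes L′)) ⟩
      occ L + 0 + 0                     ≡⟨ cong (λ y → occ L + y + 0) (*-zeroʳ (suffixes L)) ⟨
      occ L + suffixes L * 0 + 0        ≡⟨ occ-node L nil ⟨
      occ (node L nil)                  ∎
      where open ≡-Reasoning
    occ-graft (right {L} {R} {R′} g) = begin
      occ (node L R′)
        ≡⟨ occ-node L R′ ⟩
      occ L + suffixes L * ind (suc b ≤? lead R′) + occ R′
        ≡⟨ cong₂ (λ x y → occ L + suffixes L * x + y)
             (sym (ind-⇔ (suc b ≤? lead R) (suc b ≤? lead R′) (lead-graft g))) (occ-graft g) ⟩
      occ L + suffixes L * ind (suc b ≤? lead R) + occ R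
        ≡⟨ occ-node L R ⟨
      occ (node L R) ∎
      where open ≡-Reasoning

-- Generating functions

∑ : ∀ {A : Set} → List A → (A → ℕ) → ℕ
∑ xs h = sum (map h xs)

∑-++ : ∀ {A : Set} (xs ys : List A) h → ∑ (xs ++ ys) h ≡ ∑ xs h + ∑ ys h
∑-++ xs ys h = trans (cong sum (map-++ h xs ys)) (sum-++ (map h xs) (map h ys))

∑-cong : ∀ {A : Set} (xs : List A) {h h′} → (∀ {x} → x ∈ xs → h x ≡ h′ x) → ∑ xs h ≡ ∑ xs h′
∑-cong []       eq = refl
∑-cong (x ∷ xs) eq = cong₂ _+_ (eq (here refl)) (∑-cong xs (eq ∘ there))

∑-unique : ∀ {A : Set} {xs ys : List A} h → Unique xs → Unique ys →
           (∀ {x} → x ∈ xs ⇔ x ∈ ys) → ∑ xs h ≡ ∑ ys h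
∑-unique h uxs uys same = sum-↭ (↭.map⁺ h (∼bag⇒↭ (unique∧set⇒bag uxs uys same)))

∑-filter : ∀ {A : Set} {P : A → Set} (P? : ∀ x → Dec (P x)) xs h →
           ∑ (filter P? xs) h ≡ ∑ xs (λ x → ind (P? x) * h x)
∑-filter P? []       h = refl
∑-filter P? (x ∷ xs) h with P? x
... | true  because _ = cong₂ _+_ (sym (+-identityʳ (h x))) (∑-filter P? xs h)
... | false because _ = ∑-filter P? xs h

∑-product : ∀ {A B C : Set} (f : A → B → C) xs ys h →
            ∑ (cartesianProductWith f xs ys) h ≡ ∑ xs (λ x → ∑ ys (h ∘ f x))
∑-product f []       ys h = refl
∑-product f (x ∷ xs) ys h = trans (∑-++ (map (f x) ys) _ h)
  (cong₂ _+_ (cong sum (sym (map-∘ ys))) (∑-product f xs ys h))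

∑-linear : ∀ {A : Set} (xs : List A) (u v : A → ℕ) t m n →
           ∑ xs (λ x → u x * m + t * (v x * n)) ≡ ∑ xs u * m + t * (∑ xs v * n)
∑-linear []       u v t m n = sym (*-zeroʳ t)
∑-linear (x ∷ xs) u v t m n = trans (cong (u x * m + t * (v x * n) +_) (∑-linear xs u v t m n))
  (solve 7 (λ a b c d t m n → (a :* m :+ t :* (b :* n)) :+ (c :* m :+ t :* (d :* n))
              := (a :+ c) :* m :+ t :* ((b :+ d) :* n)) refl (u x) (v x) (∑ xs u) (∑ xs v) t m n)
  where open +-*-Solver

∑-bilinear : ∀ {A B C : Set} (f : A → B → C) xs ys {h} u v u′ v′ t →
             (∀ x y → h (f x y) ≡ u x * v y + t * (u′ x * v′ y)) →
             ∑ (cartesianProductWith f xs ys) h ≡ ∑ xs u * ∑ ys v + t * (∑ xs u′ * ∑ ys v′)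
∑-bilinear f xs ys {h} u v u′ v′ t eq = begin
  ∑ (cartesianProductWith f xs ys) h
    ≡⟨ ∑-product f xs ys h ⟩
  ∑ xs (λ x → ∑ ys (h ∘ f x))
    ≡⟨ ∑-cong xs (λ {x} _ → inner x) ⟩
  ∑ xs (λ x → u x * ∑ ys v + t * (u′ x * ∑ ys v′))
    ≡⟨ ∑-linear xs u u′ t (∑ ys v) (∑ ys v′) ⟩
  ∑ xs u * ∑ ys v + t * (∑ xs u′ * ∑ ys v′) ∎
  where
  open ≡-Reasoning
  flip-products : ∀ a b c d → a * b + t * (c * d) ≡ b * a + t * (d * c)
  flip-products a b c d = cong₂ (λ x y → x + t * y) (*-comm a b) (*-comm c d)
  inner : ∀ x → ∑ ys (h ∘ f x) ≡ u x * ∑ ys v + t * (u′ x * ∑ ys v′)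
  inner x = trans (∑-cong ys (λ {y} _ → trans (eq x y) (flip-products (u x) (v y) (u′ x) (v′ y))))
    (trans (∑-linear ys v v′ t (u x) (u′ x)) (flip-products (∑ ys v) (u x) (∑ ys v′) (u′ x)))

conv : (ℕ → ℕ) → (ℕ → ℕ) → ℕ → ℕ
conv f g zero    = f 0 * g 0
conv f g (suc n) = f 0 * g (suc n) + conv (f ∘ suc) g n

conv-cong : ∀ {f f′ g g′} n → (∀ {i} → i ≤ n → f i ≡ f′ i) → (∀ {i} → i ≤ n → g i ≡ g′ i) →
            conv f g n ≡ conv f′ g′ n
conv-cong zero    eqf eqg = cong₂ _*_ (eqf z≤n) (eqg z≤n)
conv-cong (suc n) eqf eqg = cong₂ _+_ (cong₂ _*_ (eqf z≤n) (eqg ≤-refl))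
  (conv-cong n (eqf ∘ s≤s) (eqg ∘ m≤n⇒m≤1+n))

-- On coefficient sequences this is multiplication by the k-th power of the variable, while `conv`
-- is the product of power series.
shift : ℕ → (ℕ → ℕ) → ℕ → ℕ
shift zero    f n       = f n
shift (suc k) f zero    = 0
shift (suc k) f (suc n) = shift k f n

shift-cong : ∀ k n {f g} → (∀ {i} → i ≤ n → f i ≡ g i) → shift k f n ≡ shift k g n
shift-cong zero    n       eq = eq ≤-refl
shift-cong (suc k) zero    eq = refl
shift-cong (suc k) (suc n) eq = shift-cong k n (eq ∘ m≤n⇒m≤1+n)

shift-+ : ∀ k f n → shift k f (k + n) ≡ f n
shift-+ zero    f n = refl
shift-+ (suc k) f n = shift-+ k f n

shift-< : ∀ {k} f {n} → n < k → shift k f n ≡ 0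
shift-< {suc k} f {zero}  _       = refl
shift-< {suc k} f {suc n} (s≤s p) = shift-< {k} f p

shift-shift : ∀ k l f n → shift k (shift l f) n ≡ shift (k + l) f n
shift-shift zero    l f n       = refl
shift-shift (suc k) l f zero    = refl
shift-shift (suc k) l f (suc n) = shift-shift k l f n

conv-shiftˡ : ∀ k f g n → conv (shift k f) g n ≡ shift k (conv f g) n
conv-shiftˡ zero    f g n       = refl
conv-shiftˡ (suc k) f g zero    = refl
conv-shiftˡ (suc k) f g (suc n) = conv-shiftˡ k f g n

conv-shiftʳ : ∀ k f g n → conv f (shift k g) n ≡ shift k (conv f g) n
conv-shiftʳ zero    f g n       = refl
conv-shiftʳ (suc k) f g zero    = *-zeroʳ (f 0)
conv-shiftʳ (suc k) f g (suc n) = trans (step f n) (conv-shiftʳ k f g n)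
  where
  step : ∀ f n → conv f (shift (suc k) g) (suc n) ≡ conv f (shift k g) n
  step f zero    = trans (cong (f 0 * shift k g 0 +_) (*-zeroʳ (f 1))) (+-identityʳ _)
  step f (suc n) = cong (f 0 * shift k g (suc n) +_) (step (f ∘ suc) n)

-- The recursion copies that of `conv`, so sums over `splits` become convolutions clause by clause.
-- It shifts only the left family, so `F` and `G` are kept apart.
splits : (ℕ → List Tree) → (ℕ → List Tree) → ℕ → List Tree
splits F G zero    = cartesianProductWith node (F 0) (G 0)
splits F G (suc n) = cartesianProductWith node (F 0) (G (suc n)) ++ splits (F ∘ suc) G n

∈-splits⁺ : ∀ F G i j {L R} → L ∈ F i → R ∈ G j → node L R ∈ splits F G (i + j)
∈-splits⁺ F G zero    zero    p q = ∈-cartesianProductWith⁺ node p q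
∈-splits⁺ F G zero    (suc j) p q = ∈-++⁺ˡ (∈-cartesianProductWith⁺ node p q)
∈-splits⁺ F G (suc i) j       p q = ∈-++⁺ʳ (cartesianProductWith node (F 0) (G (suc (i + j))))
                                      (∈-splits⁺ (F ∘ suc) G i j p q)

∈-splits⁻ : ∀ F G n {T} → T ∈ splits F G n →
            ∃[ i ] ∃[ j ] ∃[ L ] ∃[ R ] i + j ≡ n × T ≡ node L R × L ∈ F i × R ∈ G j
∈-splits⁻ F G zero p with L , R , L∈ , R∈ , eq ← ∈-cartesianProductWith⁻ node (F 0) (G 0) p =
  0 , 0 , L , R , refl , eq , L∈ , R∈
∈-splits⁻ F G (suc n) p with ∈-++⁻ (cartesianProductWith node (F 0) (G (suc n))) p
... | inj₁ q with L , R , L∈ , R∈ , eq ← ∈-cartesianProductWith⁻ node (F 0) (G (suc n)) q =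
  0 , suc n , L , R , refl , eq , L∈ , R∈
... | inj₂ q with i , j , L , R , i+j , eq , L∈ , R∈ ← ∈-splits⁻ (F ∘ suc) G n q =
  suc i , j , L , R , cong suc i+j , eq , L∈ , R∈

-- `d` counts the shifts already applied to `F`. Left subtrees from different `F i` differ in size,
-- which makes the concatenated pieces disjoint.
splits-unique : ∀ F G d n → (∀ i {L} → L ∈ F i → size L ≡ d + i) →
                (∀ i → Unique (F i)) → (∀ j → Unique (G j)) → Unique (splits F G n)
splits-unique F G d zero    _     uF uG = Uniqueₚ.cartesianProductWith⁺ node node-injective (uF 0) (uG 0)
splits-unique F G d (suc n) sizes uF uG = Uniqueₚ.++⁺
  (Uniqueₚ.cartesianProductWith⁺ node node-injective (uF 0) (uG (suc n)))
  (splits-unique (F ∘ suc) G (suc d) n (λ i p → trans (sizes (suc i) p) (+-suc d i)) (uF ∘ suc) uG)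
  disjoint
  where
  disjoint : ∀ {T} → ¬ (T ∈ cartesianProductWith node (F 0) (G (suc n)) × T ∈ splits (F ∘ suc) G n)
  disjoint (p , q)
    with L , R , L∈ , _ , refl ← ∈-cartesianProductWith⁻ node (F 0) (G (suc n)) p
    with i , _ , _ , _ , _ , refl , L∈′ , _ ← ∈-splits⁻ (F ∘ suc) G n q
    = contradiction (+-cancelˡ-≡ d 0 (suc i) (trans (sym (sizes 0 L∈)) (sizes (suc i) L∈′))) λ ()

-- The first argument bounds the depth of the recursion; it plays no role once it exceeds the size.
trees : ℕ → ℕ → List Tree
trees zero    n       = []
trees (suc k) zero    = nil ∷ []
trees (suc k) (suc n) = splits (trees k) (trees k) n

trees-sound : ∀ k n {T} → T ∈ trees k n → size T ≡ n
trees-sound (suc k) zero    (here refl) = refl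
trees-sound (suc k) (suc n) p with i , j , _ , _ , refl , refl , L∈ , R∈ ← ∈-splits⁻ (trees k) (trees k) n p =
  cong suc (cong₂ _+_ (trees-sound k i L∈) (trees-sound k j R∈))

trees-complete : ∀ k T → size T < k → T ∈ trees k (size T)
trees-complete (suc k) nil        _       = here refl
trees-complete (suc k) (node L R) (s≤s p) = ∈-splits⁺ (trees k) (trees k) (size L) (size R)
  (trees-complete k L (≤-<-trans (m≤m+n _ _) p)) (trees-complete k R (≤-<-trans (m≤n+m _ _) p))

trees-unique : ∀ k n → Unique (trees k n)
trees-unique zero    n       = []
trees-unique (suc k) zero    = [] ∷ []
trees-unique (suc k) (suc n) =
  splits-unique (trees k) (trees k) 0 n (trees-sound k) (trees-unique k) (trees-unique k)

treesOf : ℕ → List Tree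
treesOf n = trees (suc n) n

∈-treesOf : ∀ n {T} → T ∈ treesOf n ⇔ size T ≡ n
∈-treesOf n {T} = mk⇔ (trees-sound (suc n) n) λ { refl → trees-complete (suc n) T ≤-refl }

∑-trees : ∀ {k n} h → n < k → ∑ (trees k n) h ≡ ∑ (treesOf n) h
∑-trees {k} {n} h n<k = ∑-unique h (trees-unique k n) (trees-unique (suc n) n)
  (mk⇔ (from (∈-treesOf n) ∘ trees-sound k n) λ p → complete (to (∈-treesOf n) p))
  where
  complete : ∀ {T} → size T ≡ n → T ∈ trees k n
  complete {T} refl = trees-complete k T n<k

∑-splits : ∀ F G n {h} u v u′ v′ t →
           (∀ L R → h (node L R) ≡ u L * v R + t * (u′ L * v′ R)) →
           ∑ (splits F G n) h ≡ conv (λ i → ∑ (F i) u) (λ j → ∑ (G j) v) n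
                          + t * conv (λ i → ∑ (F i) u′) (λ j → ∑ (G j) v′) n
∑-splits F G zero    u v u′ v′ t eq = ∑-bilinear node (F 0) (G 0) u v u′ v′ t eq
∑-splits F G (suc n) {h} u v u′ v′ t eq = begin
  ∑ (cartesianProductWith node (F 0) (G (suc n)) ++ splits (F ∘ suc) G n) h
    ≡⟨ ∑-++ (cartesianProductWith node (F 0) (G (suc n))) _ h ⟩
  ∑ (cartesianProductWith node (F 0) (G (suc n))) h + ∑ (splits (F ∘ suc) G n) h
    ≡⟨ cong₂ _+_ (∑-bilinear node (F 0) (G (suc n)) u v u′ v′ t eq)
                 (∑-splits (F ∘ suc) G n u v u′ v′ t eq) ⟩
  (a + t * b) + (c + t * d)
    ≡⟨ solve 5 (λ a b c d t → (a :+ t :* b) :+ (c :+ t :* d) := (a :+ c) :+ t :* (b :+ d)) refl a b c d t ⟩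
  (a + c) + t * (b + d) ∎
  where
  open ≡-Reasoning
  open +-*-Solver
  a b c d : ℕ
  a = ∑ (F 0) u * ∑ (G (suc n)) v
  b = ∑ (F 0) u′ * ∑ (G (suc n)) v′
  c = conv (λ i → ∑ (F (suc i)) u) (λ j → ∑ (G j) v) n
  d = conv (λ i → ∑ (F (suc i)) u′) (λ j → ∑ (G j) v′) n

∑-nodes : ∀ n {h} u v u′ v′ t →
          (∀ L R → h (node L R) ≡ u L * v R + t * (u′ L * v′ R)) →
          ∑ (treesOf (suc n)) h ≡ conv (λ i → ∑ (treesOf i) u) (λ j → ∑ (treesOf j) v) n
                            + t * conv (λ i → ∑ (treesOf i) u′) (λ j → ∑ (treesOf j) v′) n
∑-nodes n u v u′ v′ t eq = trans (∑-splits (trees (suc n)) (trees (suc n)) n u v u′ v′ t eq)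
  (cong₂ (λ x y → x + t * y) (conv-cong n (∑-trees u ∘ s≤s) (∑-trees v ∘ s≤s))
                             (conv-cong n (∑-trees u′ ∘ s≤s) (∑-trees v′ ∘ s≤s)))

-- Removes the constant term: `graft` and `stem` are applied to nonempty trees only.
positivePart : (ℕ → ℕ) → ℕ → ℕ
positivePart f zero    = 0
positivePart f (suc n) = f (suc n)

-- `g` is a weight-preserving bijection from the nonempty trees to those with property `Q`, and
-- raises sizes by `k`. Sizes up to `k` therefore contribute nothing.
∑-image : ∀ {Q : Tree → Set} (Q? : ∀ T → Dec (Q T)) (g : Tree → Tree) k w →
          (∀ {T T′} → g T ≡ g T′ → T ≡ T′) →
          (∀ T → Q T ⇔ (∃[ T′ ] 0 < size T′ × T ≡ g T′)) →
          (∀ T → 0 < size T → size (g T) ≡ k + size T) →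
          (∀ T → 0 < size T → w (g T) ≡ w T) →
          ∀ n → ∑ (treesOf n) (λ T → ind (Q? T) * w T) ≡
                shift k (positivePart (λ j → ∑ (treesOf j) w)) n
∑-image Q? g k w inj image size-g w-g n = trans (sym (∑-filter Q? (treesOf n) w)) (main n (n <? k))
  where
  A : ℕ → ℕ
  A j = ∑ (treesOf j) w
  unique-filter : ∀ n → Unique (filter Q? (treesOf n))
  unique-filter n = Uniqueₚ.filter⁺ Q? (trees-unique (suc n) n)
  ∈-filter⇒ : ∀ n {T} → T ∈ filter Q? (treesOf n) → ∃[ T′ ] 0 < size T′ × T ≡ g T′ × k + size T′ ≡ n
  ∈-filter⇒ n T∈ with p , q ← ∈-filter⁻ Q? T∈ with T′ , r , refl ← to (image _) q =
    T′ , r , refl , trans (sym (size-g T′ r)) (to (∈-treesOf n) p)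
  empty : ∀ n → (∀ {T′} → 0 < size T′ → k + size T′ ≢ n) → ∑ (filter Q? (treesOf n)) w ≡ 0
  empty n none = ∑-unique w (unique-filter n) [] (mk⇔
    (λ T∈ → let T′ , r , _ , eq = ∈-filter⇒ n T∈ in contradiction eq (none r)) λ ())
  main : ∀ n → Dec (n < k) → ∑ (filter Q? (treesOf n)) w ≡ shift k (positivePart A) n
  main n (yes n<k) = trans (empty n λ { _ refl → <⇒≱ n<k (m≤m+n k _) }) (sym (shift-< {k} (positivePart A) n<k))
  main n (no n≮k) with j , refl ← m≤n⇒∃[o]m+o≡n (≮⇒≥ n≮k) = trans (exact j) (sym (shift-+ k (positivePart A) j))
    where
    exact : ∀ j → ∑ (filter Q? (treesOf (k + j))) w ≡ positivePart A j
    exact zero    = empty (k + 0) λ r eq → <⇒≢ r (sym (+-cancelˡ-≡ k _ _ eq))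
    exact (suc j) = begin
      ∑ (filter Q? (treesOf (k + suc j))) w
        ≡⟨ ∑-unique w (unique-filter (k + suc j)) (Uniqueₚ.map⁺ inj (trees-unique (suc (suc j)) (suc j))) (mk⇔ fwd bwd) ⟩
      ∑ (map g (treesOf (suc j))) w
        ≡⟨ cong sum (map-∘ (treesOf (suc j))) ⟨
      ∑ (treesOf (suc j)) (w ∘ g)
        ≡⟨ ∑-cong (treesOf (suc j)) (λ {T} T∈ → w-g T (positive T∈)) ⟩
      A (suc j) ∎
      where
      open ≡-Reasoning
      positive : ∀ {T} → T ∈ treesOf (suc j) → 0 < size T
      positive T∈ = subst (0 <_) (sym (to (∈-treesOf (suc j)) T∈)) (s≤s z≤n)
      fwd : ∀ {T} → T ∈ filter Q? (treesOf (k + suc j)) → T ∈ map g (treesOf (suc j))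
      fwd T∈ with T′ , _ , refl , eq ← ∈-filter⇒ (k + suc j) T∈ =
        ∈-map⁺ g (from (∈-treesOf (suc j)) (+-cancelˡ-≡ k _ _ eq))
      bwd : ∀ {T} → T ∈ map g (treesOf (suc j)) → T ∈ filter Q? (treesOf (k + suc j))
      bwd T∈ with T′ , T′∈ , refl ← ∈-map⁻ g T∈ = ∈-filter⁺ Q?
        (from (∈-treesOf (k + suc j)) (trans (size-g T′ (positive T′∈)) (cong (k +_) (to (∈-treesOf (suc j)) T′∈))))
        (from (image _) (T′ , positive T′∈ , refl))

-- `t` is q - 1; `d` will be (a - 1) + (b - 1), the sizes added by grafting `ρ` and by the stem.
Recurrence : ℕ → ℕ → (ℕ → ℕ) → Set
Recurrence t d A = ∀ n → A (suc n) ≡ conv A A n + t * shift d (conv (positivePart A) (positivePart A)) n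

recurrence-unique : ∀ t d A A′ → A 0 ≡ A′ 0 → Recurrence t d A → Recurrence t d A′ → ∀ n → A n ≡ A′ n
recurrence-unique t d A A′ eq₀ rec rec′ n = agree n ≤-refl
  where
  agree : ∀ n {i} → i ≤ n → A i ≡ A′ i
  agree n       z≤n     = eq₀
  agree (suc n) {suc i} (s≤s i≤n) = begin
    A (suc i)
      ≡⟨ rec i ⟩
    conv A A i + t * shift d (conv (positivePart A) (positivePart A)) i
      ≡⟨ cong₂ (λ x y → x + t * y) (conv-cong i below below)
           (shift-cong d i λ {j} j≤i → conv-cong j
             (λ p → positive (≤-trans p j≤i)) (λ p → positive (≤-trans p j≤i))) ⟩
    conv A′ A′ i + t * shift d (conv (positivePart A′) (positivePart A′)) i
      ≡⟨ rec′ i ⟨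
    A′ (suc i) ∎
    where
    open ≡-Reasoning
    below : ∀ {j} → j ≤ i → A j ≡ A′ j
    below j≤i = agree n (≤-trans j≤i i≤n)
    positive : ∀ {j} → j ≤ i → positivePart A j ≡ positivePart A′ j
    positive {zero}  _   = refl
    positive {suc j} j≤i = below j≤i

-- For e equal to 0 or 1, q^e = 1 + (q - 1) e; here e is a product of indicators, one for each
-- subtree.
weight-split : ∀ t x y {A B : Set} (a? : Dec A) (b? : Dec B) →
               suc t ^ (x + ind a? * ind b? + y) ≡
               suc t ^ x * suc t ^ y + t * ((ind a? * suc t ^ x) * (ind b? * suc t ^ y))
weight-split t x y a? b? with indicator a? | indicator b?
  where
  indicator : ∀ {A : Set} (a? : Dec A) → ind a? ≡ 0 ⊎ ind a? ≡ 1
  indicator (true  because _) = inj₂ refl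
  indicator (false because _) = inj₁ refl
... | inj₁ p | _ rewrite p | +-identityʳ x | *-zeroʳ t | +-identityʳ (suc t ^ x * suc t ^ y) = ^-distribˡ-+-* (suc t) x y
... | inj₂ p | inj₁ q rewrite p | q | +-identityʳ x | *-zeroʳ (suc t ^ x + 0) | *-zeroʳ t
                            | +-identityʳ (suc t ^ x * suc t ^ y) = ^-distribˡ-+-* (suc t) x y
... | inj₂ p | inj₂ q rewrite p | q = begin
  suc t ^ (x + 1 + y)                ≡⟨ cong (suc t ^_) (trans (+-assoc x 1 y) (+-suc x y)) ⟩
  suc t * suc t ^ (x + y)            ≡⟨ cong (suc t *_) (^-distribˡ-+-* (suc t) x y) ⟩
  suc t * (X * Y)                    ≡⟨ cong (λ z → X * Y + t * z) (cong₂ _*_ (+-identityʳ X) (+-identityʳ Y)) ⟨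
  X * Y + t * ((X + 0) * (Y + 0))    ∎
  where
  open ≡-Reasoning
  X Y : ℕ
  X = suc t ^ x
  Y = suc t ^ y

-- Recovering a distribution from one value

count : ℕ → List ℕ → ℕ
count k es = ∑ es (λ e → ind (e ≟ k))

-- For a sum of powers of q this removes the units digit and divides by q, as `value-step` states.
predecessors : List ℕ → List ℕ
predecessors []           = []
predecessors (zero  ∷ es) = predecessors es
predecessors (suc e ∷ es) = e ∷ predecessors es

length-predecessors : ∀ es → length (predecessors es) ≤ length es
length-predecessors []           = z≤n
length-predecessors (zero  ∷ es) = m≤n⇒m≤1+n (length-predecessors es)
length-predecessors (suc e ∷ es) = s≤s (length-predecessors es)

count-suc : ∀ k es → count (suc k) es ≡ count k (predecessors es)
count-suc k []           = refl
count-suc k (zero  ∷ es) = count-suc k es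
count-suc k (suc e ∷ es) = cong₂ _+_
  (ind-⇔ (suc e ≟ suc k) (e ≟ k) (mk⇔ suc-injective (cong suc))) (count-suc k es)

count≤length : ∀ k es → count k es ≤ length es
count≤length k [] = z≤n
count≤length k (e ∷ es) with e ≟ k
... | true  because _ = s≤s (count≤length k es)
... | false because _ = m≤n⇒m≤1+n (count≤length k es)

value-step : ∀ q es → ∑ es (q ^_) ≡ count 0 es + ∑ (predecessors es) (q ^_) * q
value-step q []           = refl
value-step q (zero  ∷ es) = cong suc (value-step q es)
value-step q (suc e ∷ es) = trans (cong (q * q ^ e +_) (value-step q es))
  (solve 4 (λ q p c v → q :* p :+ (c :+ v :* q) := c :+ (p :+ v) :* q) refl
    q (q ^ e) (count 0 es) (∑ (predecessors es) (q ^_)))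
  where open +-*-Solver

-- The multiplicities of the exponents are the digits in base q of the sum of powers.
digits-unique : ∀ t k es es′ → length es < suc t → length es′ < suc t →
                ∑ es (suc t ^_) ≡ ∑ es′ (suc t ^_) → count k es ≡ count k es′
digits-unique t k es es′ p p′ eq = go k
  where
  q : ℕ
  q = suc t
  V V′ : ℕ
  V  = ∑ (predecessors es) (q ^_)
  V′ = ∑ (predecessors es′) (q ^_)
  eq′ : count 0 es + V * q ≡ count 0 es′ + V′ * q
  eq′ = trans (sym (value-step q es)) (trans eq (value-step q es′))
  -- Fewer than q exponents are present, so the count of zeros is a genuine digit and no carry
  -- occurs.
  last-digit : ∀ es v → length es < q → (count 0 es + v * q) % q ≡ count 0 es
  last-digit es v p = trans ([m+kn]%n≡m%n (count 0 es) v q) (m<n⇒m%n≡m (≤-<-trans (count≤length 0 es) p))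
  count₀ : count 0 es ≡ count 0 es′
  count₀ = trans (sym (last-digit es V p)) (trans (cong (_% q) eq′) (last-digit es′ V′ p′))
  V≡V′ : V ≡ V′
  V≡V′ = *-cancelʳ-≡ V V′ q (+-cancelˡ-≡ (count 0 es) _ _ (trans eq′ (cong (_+ V′ * q) (sym count₀))))
  go : ∀ k → count k es ≡ count k es′
  go zero    = count₀
  go (suc k) = trans (count-suc k es) (trans
    (digits-unique t k (predecessors es) (predecessors es′)
      (≤-<-trans (length-predecessors es) p) (≤-<-trans (length-predecessors es′) p′) V≡V′)
    (sym (count-suc k es′)))

-- The recurrence for the occurrence statistic

generating : (Tree → ℕ) → ℕ → ℕ → ℕ
generating s t n = ∑ (treesOf n) (λ T → suc t ^ s T)

graft-nonempty-injective : ∀ PL PR {T T′} → graft (node PL PR) T ≡ graft (node PL PR) T′ → T ≡ T′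
graft-nonempty-injective PL PR {nil}    {nil}    _ = refl
graft-nonempty-injective PL PR {nil}    {T′@(node _ _)} eq =
  contradiction (cong size eq) (<⇒≢ (graft-target PL PR 0 (graft-Graft _ T′ (s≤s z≤n))))
graft-nonempty-injective PL PR {T@(node _ _)} {nil} eq =
  contradiction (cong size (sym eq)) (<⇒≢ (graft-target PL PR 0 (graft-Graft _ T (s≤s z≤n))))
graft-nonempty-injective PL PR {T@(node _ _)} {T′@(node _ _)} eq = graft-injective PL PR 0
  (graft-Graft _ T (s≤s z≤n)) (subst (Graft _ T′) (sym eq) (graft-Graft _ T′ (s≤s z≤n)))

occ-recurrence : ∀ PL PR b → (2 ≤ suc b → lead (node PL PR) ≡ 1) → ∀ t →
                 Recurrence t (size PL + size PR + b) (generating (occ PL PR b) t)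
occ-recurrence PL PR b single t n = begin
  A (suc n)
    ≡⟨ ∑-nodes n w w wS wB t node-weight ⟩
  conv A A n + t * conv (λ i → ∑ (treesOf i) wS) (λ j → ∑ (treesOf j) wB) n
    ≡⟨ cong (λ z → conv A A n + t * z) (conv-cong n (λ {i} _ → S-sum i) (λ {j} _ → B-sum j)) ⟩
  conv A A n + t * conv (shift a A⁺) (shift b A⁺) n
    ≡⟨ cong (λ z → conv A A n + t * z) shifts ⟩
  conv A A n + t * shift (a + b) (conv A⁺ A⁺) n ∎
  where
  open ≡-Reasoning
  a : ℕ
  a = size PL + size PR
  o : Tree → ℕ
  o = occ PL PR b
  A A⁺ : ℕ → ℕ
  A = generating o t
  A⁺ = positivePart A
  S? : ∀ L → Dec (1 ≤ suffixes PL PR b L)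
  S? L = 1 ≤? suffixes PL PR b L
  B? : ∀ R → Dec (suc b ≤ lead R)
  B? R = suc b ≤? lead R
  w wS wB : Tree → ℕ
  w T = suc t ^ o T
  wS L = ind (S? L) * w L
  wB R = ind (B? R) * w R
  node-weight : ∀ L R → w (node L R) ≡ w L * w R + t * (wS L * wB R)
  node-weight L R = trans (cong (suc t ^_) (trans (occ-node PL PR b L R)
      -- The suffix count must become an indicator before `weight-split` can linearise the exponent.
      (cong (λ s → o L + s * ind (B? R) + o R) (suffixes-ind PL PR b L))))
    (weight-split t (o L) (o R) (S? L) (B? R))
  S-sum : ∀ i → ∑ (treesOf i) wS ≡ shift a A⁺ i
  S-sum = ∑-image S? (graft (node PL PR)) a w (graft-nonempty-injective PL PR)
    (suffixes-graft PL PR b)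
    (λ T p → size-graft PL PR b (graft-Graft _ T p))
    (λ T p → cong (suc t ^_) (occ-graft PL PR b single (graft-Graft _ T p)))
  B-sum : ∀ j → ∑ (treesOf j) wB ≡ shift b A⁺ j
  B-sum = ∑-image B? (stem b) b w (stem-injective b) (lead-stem b)
    (λ T _ → size-stem b T) (λ T _ → cong (suc t ^_) (occ-stem PL PR b b T))
  shifts : conv (shift a A⁺) (shift b A⁺) n ≡ shift (a + b) (conv A⁺ A⁺) n
  shifts = trans (conv-shiftˡ a A⁺ (shift b A⁺) n)
    (trans (shift-cong a n λ {i} _ → conv-shiftʳ b A⁺ A⁺ i) (shift-shift a b (conv A⁺ A⁺) n))

-- From trees back to partitions

length-filter-count : ∀ (s : Tree → ℕ) k xs → length (filter (λ T → s T ≟ k) xs) ≡ count k (map s xs)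
length-filter-count s k [] = refl
length-filter-count s k (T ∷ xs) = trans (length-filter-∷ (λ T → s T ≟ k) T xs)
  (cong (ind (s T ≟ k) +_) (length-filter-count s k xs))

module _ (PL PR : Tree) (b : ℕ) where

  private
    τ : Word
    τ = pattern[ form (node PL PR) , suc b ]

  μ-form : ∀ T → μ τ (form T) ≡ occ PL PR b T
  μ-form T = μ≡occurrences τ (form T) (s≤s z≤n)

  cardinality : ∀ n k → HasCardinality (λ π → NC n π × μ τ π ≡ k) (count k (map (occ PL PR b) (treesOf n)))
  cardinality n k = map form selected
    , Uniqueₚ.map⁺ (word-injective _ _ (n<1+n 1)) (Uniqueₚ.filter⁺ matches? (trees-unique (suc n) n))
    , (λ w → mk⇔ fwd bwd)
    , trans (length-map form selected) (length-filter-count (occ PL PR b) k (treesOf n))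
    where
    matches? : ∀ T → Dec (occ PL PR b T ≡ k)
    matches? T = occ PL PR b T ≟ k
    selected : List Tree
    selected = filter matches? (treesOf n)
    fwd : ∀ {w} → w ∈ map form selected → NC n w × μ τ w ≡ k
    fwd w∈ with T , T∈ , refl ← ∈-map⁻ form w∈ with T∈′ , eq ← ∈-filter⁻ matches? T∈ =
      subst (λ n → NC n (form T)) (to (∈-treesOf n) T∈′) (form-NC T) , trans (μ-form T) eq
    bwd : ∀ {w} → NC n w × μ τ w ≡ k → w ∈ map form selected
    bwd (nc , eq) with T , refl , refl ← NC-form nc =
      ∈-map⁺ form (∈-filter⁺ matches? (from (∈-treesOf n) refl) (trans (sym (μ-form T)) eq))

mainTheorem6 : (a b a′ b′ : ℕ) → 1 ≤ a → 1 ≤ b → 1 ≤ a′ → 1 ≤ b′ → a + b ≡ a′ + b′ →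
    (ρ ρ′ : Word) → NC a ρ → NC a′ ρ′ →
    (2 ≤ b → initialOnes ρ ≡ 1) → (2 ≤ b′ → initialOnes ρ′ ≡ 1) →
    pattern[ ρ , b ] ≡ᴺᶜ pattern[ ρ′ , b′ ]
mainTheorem6 a (suc b) a′ (suc b′) 1≤a _ 1≤a′ _ a+b ρ ρ′ nc nc′ single single′ n k
  with NC-form nc | NC-form nc′
... | nil , refl , _ | _ = contradiction 1≤a λ ()
... | _ | nil , refl , _ = contradiction 1≤a′ λ ()
... | node PL PR , refl , refl | node PL′ PR′ , refl , refl =
  count k es , cardinality PL PR b n k ,
  subst (HasCardinality _) (sym same-count) (cardinality PL′ PR′ b′ n k)
  where
  es es′ : List ℕ
  es  = map (occ PL PR b) (treesOf n)
  es′ = map (occ PL′ PR′ b′) (treesOf n)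
  -- The base t + 1 has to exceed the lengths of both lists of exponents at once, so the sum of the
  -- lengths serves as `t`.
  t : ℕ
  t = length es + length es′
  lead-single : ∀ {T b} → (2 ≤ b → initialOnes (form T) ≡ 1) → 2 ≤ b → lead T ≡ 1
  lead-single {T} single p = trans (sym (initialOnes-word T (n<1+n 1))) (single p)
  -- Here `b` and `b′` are already reduced by one and the root of each tree is left out, so the
  -- equality of the sums of lengths loses 2 on both sides.
  same-shift : size PL′ + size PR′ + b′ ≡ size PL + size PR + b
  same-shift = suc-injective (suc-injective (trans (cong suc (sym (+-suc _ b′)))
    (trans (sym a+b) (cong suc (+-suc _ b)))))
  A A′ : ℕ → ℕ
  A  = generating (occ PL PR b) t
  A′ = generating (occ PL′ PR′ b′) t
  same-generating : A n ≡ A′ n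
  same-generating = recurrence-unique t (size PL + size PR + b) A A′ refl
    (occ-recurrence PL PR b (lead-single single) t)
    (subst (λ d → Recurrence t d A′) same-shift (occ-recurrence PL′ PR′ b′ (lead-single single′) t)) n
  same-count : count k es ≡ count k es′
  same-count = digits-unique t k es es′ (s≤s (m≤m+n _ _)) (s≤s (m≤n+m _ _))
    (trans (cong sum (sym (map-∘ (treesOf n)))) (trans same-generating (cong sum (map-∘ (treesOf n)))))
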